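{- There are absolute constants $c_1,c_2>0$ such that the following holds. Let $G=(V,E)$ be a connected, unweighted, undirected (multi-)graph with $|V|\ge 2$ and min-cut value $\lambda$, and let $0<\varepsilon\le 1$. There exists a tree-packing $\mathcal T$ of $G$ with $c_1\lambda/\varepsilon\le|\mathcal T|\le c_2\lambda/\varepsilon$ (i.e. $|\mathcal T|=\Theta(\lambda/\varepsilon)$) trees that satisfies $$|\ell^{\mathcal T}(e)-\ell^*(e)|\le \varepsilon/\lambda\qquad\text{for all } e\in E.$$
   Context: Multigraphs may have parallel edges but no self-loops. A tree-packing $\mathcal T$ of $G$ is a finite family of spanning trees of $G$ (repetitions allowed; an edge can appear in several trees). The load $L^{\mathcal T}(e)$ of an edge is the number of trees of $\mathcal T$ containing $e$, and the relative load is $\ell^{\mathcal T}(e)=L^{\mathcal T}(e)/|\mathcal T|$. The min-cut value $\lambda$ is the minimum number of edges whose deletion disconnects $G$. For a partition $\mathcal P$ of $V$ with $|\mathcal P|\ge 2$, $G/\mathcal P$ is obtained by contracting each class to a vertex; $E(G/\mathcal P)$ is the set of edges of $G$ whose endpoints lie in different classes. Put $\mathrm{part\_val}(\mathcal P)=\frac{|E(G/\mathcal P)|}{|\mathcal P|-1}$ and $\Phi_G=\min_{\mathcal P}\mathrm{part\_val}(\mathcal P)$. The ideal relative loads $\ell^*(e)$ are defined recursively: (1) let $\mathcal P^*$ be a partition of $V$ with $\mathrm{part\_val}(\mathcal P^*)=\Phi_G$; (2) for all $e\in E(G/\mathcal P^*)$ set $\ell^*(e)=1/\Phi_G$; (3)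 for each $S\in\mathcal P^*$ (with $|S|\ge 2$) recurse on the induced subgraph $G[S]$. (These values do not depend on the choices of $\mathcal P^*$.) -}

module Defs where

open import Data.Bool.Base using (_∧_; not)
open import Data.Fin.Base using (Fin)
open import Data.Fin.Properties using (_≟_)
open import Data.Fin.Subset using (Subset; _∈_; ⊤; ∁; ∣_∣)
open import Data.Fin.Subset.Properties using (x∈p⇒∣p-x∣<∣p∣)
open import Data.Integer.Base using (+_)
open import Data.List.Base using (List; []; _∷_)
open import Data.List.Relation.Unary.Unique.Propositional using (Unique)
open import Data.Nat.Base as ℕ using (ℕ; suc)
import Data.Nat.Properties as ℕ
open import Data.Product.Base using (∃; ∃-syntax; _×_)
open import Data.Rational.Base using (ℚ; _/_; 1/_; _<_; _≤_; NonZero)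
open import Data.Rational.Properties using (normalize-pos; pos⇒nonZero)
open import Data.Sum.Base using (_⊎_)
open import Data.Vec.Base using (lookup; tabulate)
open import Relation.Binary.PropositionalEquality.Core using (_≡_; _≢_)
open import Relation.Nullary.Decidable.Core using (does)
open import Relation.Nullary.Negation.Core using (¬_)

-- Dedekind reals: q <ʳ x and x ʳ< q are the lower and the upper cut of x.

record ℝ : Set₁ where
  field
    Lower Upper : ℚ → Set
    lower-inhabited : ∃ Lower
    upper-inhabited : ∃ Upper
    lower-closed    : ∀ {p q} → p < q → Lower q → Lower p
    lower-open      : ∀ {p} → Lower p → ∃[ q ] p < q × Lower q
    upper-closed    : ∀ {p q} → p < q → Upper p → Upper q
    upper-open      : ∀ {q} → Upper q → ∃[ p ] p < q × Upper p
    disjoint        : ∀ {q} → ¬ (Lower q × Upper q)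
    located         : ∀ {p q} → p < q → Lower p ⊎ Upper q

infix 4 _<ʳ_ _ʳ<_ _≤ʳ_ _ʳ≤_

_<ʳ_ : ℚ → ℝ → Set
q <ʳ x = ℝ.Lower x q

_ʳ<_ : ℝ → ℚ → Set
x ʳ< q = ℝ.Upper x q

_≤ʳ_ : ℚ → ℝ → Set
q ≤ʳ x = ¬ (x ʳ< q)

_ʳ≤_ : ℝ → ℚ → Set
x ʳ≤ q = ¬ (q <ʳ x)

-- The order of an edge's two ends is arbitrary; see Joins.

record Multigraph : Set where
  field
    #V #E   : ℕ
    end₁    : Fin #E → Fin #V
    end₂    : Fin #E → Fin #V
    no-loop : ∀ e → end₁ e ≢ end₂ e

  V E : Set
  V = Fin #V
  E = Fin #E

∈⇒nonZero : ∀ {n} {p : Subset n} {x} → x ∈ p → ℕ.NonZero ∣ p ∣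
∈⇒nonZero x∈p = ℕ.>-nonZero (ℕ.≤-trans (ℕ.s≤s ℕ.z≤n) (x∈p⇒∣p-x∣<∣p∣ x∈p))

module _ (G : Multigraph) where
  open Multigraph G

  Joins : E → V → V → Set
  Joins e u v = (end₁ e ≡ u × end₂ e ≡ v) ⊎ (end₁ e ≡ v × end₂ e ≡ u)

  data Walk (F : Subset #E) : V → V → Set where
    stop : ∀ {v} → Walk F v v
    step : ∀ {u v w} (e : E) → e ∈ F → Joins e u v → Walk F v w → Walk F u w

  edges : ∀ {F u v} → Walk F u v → List E
  edges stop           = []
  edges (step e _ _ w) = e ∷ edges w

  -- All vertices visited, except the last one.
  origins : ∀ {F u v} → Walk F u v → List V
  origins stop                   = []
  origins (step {u = u} _ _ _ w) = u ∷ origins w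

  -- Two parallel edges form a cycle.  Distinctness of the edges rules out
  -- going back and forth along a single edge.
  IsCycle : ∀ {F v} → Walk F v v → Set
  IsCycle w = edges w ≢ [] × Unique (edges w) × Unique (origins w)

  -- An edge set F stands for the spanning subgraph (V , F).

  Connected : Subset #E → Set
  Connected F = ∀ u v → Walk F u v

  Acyclic : Subset #E → Set
  Acyclic F = ∀ {v} (w : Walk F v v) → ¬ IsCycle w

  IsSpanningTree : Subset #E → Set
  IsSpanningTree F = Connected F × Acyclic F

  Disconnecting : Subset #E → Set
  Disconnecting D = ¬ Connected (∁ D)

  IsMinCutValue : ℕ → Set
  IsMinCutValue λ# =
    (∃[ D ] Disconnecting D × ∣ D ∣ ≡ λ#) ×
    (∀ D → Disconnecting D → λ# ℕ.≤ ∣ D ∣)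

  -- Nonempty, since relative loads divide by the number of trees.
  record TreePacking : Set where
    field
      size           : ℕ
      {{nonZero}}    : ℕ.NonZero size
      tree           : Fin size → Subset #E
      isSpanningTree : ∀ i → IsSpanningTree (tree i)

    load : E → ℕ
    load e = ∣ tabulate (λ i → lookup (tree i) e) ∣

    relLoad : E → ℚ
    relLoad e = + load e / size

  -- Partitions of S ⊆ V into k nonempty classes, as surjections from S onto
  -- Fin k.  Labels of vertices outside S play no role.
  record Partition (S : Subset #V) (k : ℕ) : Set where
    field
      label : V → Fin k
      onto  : ∀ i → ∃[ v ] v ∈ S × label v ≡ i

    class : Fin k → Subset #V
    class i = tabulate (λ v → lookup S v ∧ does (label v ≟ i))

    -- E(G[S]/𝒫)
    crossing : Subset #E
    crossing = tabulate (λ e →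
      (lookup S (end₁ e) ∧ lookup S (end₂ e)) ∧
      not (does (label (end₁ e) ≟ label (end₂ e))))

  open Partition

  partVal : ∀ {S j} → Partition S (2 ℕ.+ j) → ℚ
  partVal {j = j} P = + ∣ crossing P ∣ / suc j

  partVal-nonZero : ∀ {S j} (P : Partition S (2 ℕ.+ j)) {e} →
                    e ∈ crossing P → NonZero (partVal P)
  partVal-nonZero {j = j} P e∈ =
    pos⇒nonZero (partVal P)
      {{normalize-pos ∣ crossing P ∣ (suc j) {{_}} {{∈⇒nonZero e∈}}}}

  -- 𝒫 attains Φ of the induced subgraph G[S].
  IsMinimal : ∀ {S j} → Partition S (2 ℕ.+ j) → Set
  IsMinimal {S} P = ∀ {j} (Q : Partition S (2 ℕ.+ j)) → partVal P ≤ partVal Q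

  -- IdealOn ℓ S: some run of the recursion on G[S] (with some choice of the
  -- minimising partitions) assigns to each edge e of G[S] the value ℓ e.
  data IdealOn (ℓ : E → ℚ) (S : Subset #V) : Set where
    single : ∣ S ∣ ≡ 1 → IdealOn ℓ S
    split  : ∀ {j} (P : Partition S (2 ℕ.+ j)) → IsMinimal P →
             (∀ e (e∈ : e ∈ crossing P) →
                ℓ e ≡ (1/ partVal P) {{partVal-nonZero P e∈}}) →
             (∀ i → IdealOn ℓ (class P i)) →
             IdealOn ℓ S

  IsIdealLoad : (E → ℚ) → Set
  IsIdealLoad ℓ = IdealOn ℓ ⊤

open Multigraph public
open TreePacking public

{-# OPTIONS --safe #-}
module Submission where

-- Each quotient G[S]/𝒫* has m edges and p + 1 vertices, and minimality of 𝒫* says that no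
-- partition of it has density below m / p.  It suffices to give every quotient N ≈ λ/ε spanning
-- trees in which all loads differ from N p / m by at most 1: gluing a tree of the quotient to trees
-- of the classes gives a spanning tree of G[S].
--
-- Take N spanning trees of the quotient minimising the sum of the squared loads.  Fix s and let a
-- token start at an edge of load above s; whenever it sits on an edge e of a tree and replacing e by
-- f gives a tree, it may do so and move to f.  By optimality the set R of edges the token can reach
-- has loads ≥ s, and the remaining edges K have loads ≤ s by choice of R.  Every tree spans the
-- components of K by edges of K, so its number of edges in R and in K is controlled by the number of
-- components of K; comparing with the density bound yields m s ≤ N p if R is nonempty and
-- N p ≤ m s if K is nonempty.

-- Fractions of natural numbers.

module _ where
  open import Algebra.Properties.Group using (⁻¹-anti-homo-//)
  open import Data.Integer.Base as ℤ using (+_)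
  import Data.Integer.Properties as ℤ
  open import Data.Nat.Base as ℕ using (ℕ; suc)
  import Data.Nat.Properties as ℕ
  open import Data.Nat.Tactic.RingSolver using (solve-∀)
  open import Data.Rational.Base
  open import Data.Rational.Properties
  open import Data.Rational.Unnormalised.Base as ℚᵘ using (mkℚᵘ; *≤*; *<*)
  import Data.Rational.Unnormalised.Properties as ℚᵘ
  open import Data.Sum.Base using (inj₁; inj₂)
  open import Relation.Binary.PropositionalEquality

  module _ (a b c d : ℕ) where

    /-mono-≤ : a ℕ.* suc d ℕ.≤ c ℕ.* suc b → + a / suc b ≤ + c / suc d
    /-mono-≤ le = toℚᵘ-cancel-≤ (begin
      toℚᵘ (+ a / suc b)  ≃⟨ toℚᵘ-fromℚᵘ (mkℚᵘ (+ a) b) ⟩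
      mkℚᵘ (+ a) b        ≤⟨ *≤* (subst₂ ℤ._≤_ (ℤ.pos-* a (suc d)) (ℤ.pos-* c (suc b)) (ℤ.+≤+ le)) ⟩
      mkℚᵘ (+ c) d        ≃⟨ toℚᵘ-fromℚᵘ (mkℚᵘ (+ c) d) ⟨
      toℚᵘ (+ c / suc d)  ∎)
      where open ℚᵘ.≤-Reasoning

    /-mono-< : a ℕ.* suc d ℕ.< c ℕ.* suc b → + a / suc b < + c / suc d
    /-mono-< le = toℚᵘ-cancel-< (begin-strict
      toℚᵘ (+ a / suc b)  ≃⟨ toℚᵘ-fromℚᵘ (mkℚᵘ (+ a) b) ⟩
      mkℚᵘ (+ a) b        <⟨ *<* (subst₂ ℤ._<_ (ℤ.pos-* a (suc d)) (ℤ.pos-* c (suc b)) (ℤ.+<+ le)) ⟩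
      mkℚᵘ (+ c) d        ≃⟨ toℚᵘ-fromℚᵘ (mkℚᵘ (+ c) d) ⟨
      toℚᵘ (+ c / suc d)  ∎)
      where open ℚᵘ.≤-Reasoning

    /-cancel-≤ : + a / suc b ≤ + c / suc d → a ℕ.* suc d ℕ.≤ c ℕ.* suc b
    /-cancel-≤ le with begin
      mkℚᵘ (+ a) b        ≃⟨ toℚᵘ-fromℚᵘ (mkℚᵘ (+ a) b) ⟨
      toℚᵘ (+ a / suc b)  ≤⟨ toℚᵘ-mono-≤ le ⟩
      toℚᵘ (+ c / suc d)  ≃⟨ toℚᵘ-fromℚᵘ (mkℚᵘ (+ c) d) ⟩
      mkℚᵘ (+ c) d        ∎
      where open ℚᵘ.≤-Reasoning
    ... | *≤* le′ = ℤ.drop‿+≤+ (subst₂ ℤ._≤_ (sym (ℤ.pos-* a (suc d))) (sym (ℤ.pos-* c (suc b))) le′)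

    /-+ : + a / suc b + + c / suc d ≡ + (a ℕ.* suc d ℕ.+ c ℕ.* suc b) / (suc b ℕ.* suc d)
    /-+ = toℚᵘ-injective (begin-equality
      toℚᵘ (+ a / suc b + + c / suc d)            ≃⟨ toℚᵘ-homo-+ (+ a / suc b) (+ c / suc d) ⟩
      toℚᵘ (+ a / suc b) ℚᵘ.+ toℚᵘ (+ c / suc d)
        ≃⟨ ℚᵘ.+-cong (toℚᵘ-fromℚᵘ (mkℚᵘ (+ a) b)) (toℚᵘ-fromℚᵘ (mkℚᵘ (+ c) d)) ⟩
      mkℚᵘ (+ a) b ℚᵘ.+ mkℚᵘ (+ c) d
        ≡⟨ cong (λ z → mkℚᵘ z (d ℕ.+ b ℕ.* suc d))
                (cong₂ ℤ._+_ (sym (ℤ.pos-* a (suc d))) (sym (ℤ.pos-* c (suc b)))) ⟩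
      mkℚᵘ (+ (a ℕ.* suc d ℕ.+ c ℕ.* suc b)) (d ℕ.+ b ℕ.* suc d)
        ≃⟨ toℚᵘ-fromℚᵘ (mkℚᵘ (+ (a ℕ.* suc d ℕ.+ c ℕ.* suc b)) (d ℕ.+ b ℕ.* suc d)) ⟨
      toℚᵘ (+ (a ℕ.* suc d ℕ.+ c ℕ.* suc b) / (suc b ℕ.* suc d))  ∎)
      where open ℚᵘ.≤-Reasoning

    /-* : (+ a / suc b) * (+ c / suc d) ≡ + (a ℕ.* c) / (suc b ℕ.* suc d)
    /-* = toℚᵘ-injective (begin-equality
      toℚᵘ ((+ a / suc b) * (+ c / suc d))        ≃⟨ toℚᵘ-homo-* (+ a / suc b) (+ c / suc d) ⟩
      toℚᵘ (+ a / suc b) ℚᵘ.* toℚᵘ (+ c / suc d)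
        ≃⟨ ℚᵘ.*-cong (toℚᵘ-fromℚᵘ (mkℚᵘ (+ a) b)) (toℚᵘ-fromℚᵘ (mkℚᵘ (+ c) d)) ⟩
      mkℚᵘ (+ a) b ℚᵘ.* mkℚᵘ (+ c) d
        ≡⟨ cong (λ z → mkℚᵘ z (d ℕ.+ b ℕ.* suc d)) (sym (ℤ.pos-* a c)) ⟩
      mkℚᵘ (+ (a ℕ.* c)) (d ℕ.+ b ℕ.* suc d)
        ≃⟨ toℚᵘ-fromℚᵘ (mkℚᵘ (+ (a ℕ.* c)) (d ℕ.+ b ℕ.* suc d)) ⟨
      toℚᵘ (+ (a ℕ.* c) / (suc b ℕ.* suc d))       ∎)
      where open ℚᵘ.≤-Reasoning

  1/-frac : ∀ m j .{{_ : NonZero (+ suc m / suc j)}} → 1/ (+ suc m / suc j) ≡ + suc j / suc m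
  1/-frac m j = begin
    1/ q               ≡⟨ *-identityʳ (1/ q) ⟨
    1/ q * 1ℚ          ≡⟨ cong (1/ q *_) qr≡1 ⟨
    1/ q * (q * r)     ≡⟨ *-assoc (1/ q) q r ⟨
    1/ q * q * r       ≡⟨ cong (_* r) (*-inverseˡ q) ⟩
    1ℚ * r             ≡⟨ *-identityˡ r ⟩
    r                  ∎
    where
    open ≡-Reasoning
    q r : ℚ
    q = + suc m / suc j
    r = + suc j / suc m
    qr≡1 : q * r ≡ 1ℚ
    qr≡1 = trans (/-* (suc m) j (suc j) m) (≤-antisym
      (/-mono-≤ (suc m ℕ.* suc j) (m ℕ.+ j ℕ.* suc m) 1 0 (ℕ.≤-reflexive eq))
      (/-mono-≤ 1 0 (suc m ℕ.* suc j) (m ℕ.+ j ℕ.* suc m) (ℕ.≤-reflexive (sym eq))))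
      where
      eq : suc m ℕ.* suc j ℕ.* 1 ≡ 1 ℕ.* (suc j ℕ.* suc m)
      eq = trans (ℕ.*-identityʳ _) (trans (ℕ.*-comm (suc m) (suc j)) (sym (ℕ.*-identityˡ _)))

  p≤q+r⇒p-q≤r : ∀ p q {r} → p ≤ q + r → p - q ≤ r
  p≤q+r⇒p-q≤r p q {r} le = begin
    p - q          ≤⟨ +-monoˡ-≤ (- q) le ⟩
    q + r - q      ≡⟨ cong (_- q) (+-comm q r) ⟩
    r + q - q      ≡⟨ +-assoc r q (- q) ⟩
    r + (q - q)    ≡⟨ cong (λ z → r + z) (+-inverseʳ q) ⟩
    r + 0ℚ         ≡⟨ +-identityʳ r ⟩
    r              ∎
    where open ≤-Reasoning

  ∣p-q∣≤r : ∀ {p q r} → p ≤ q + r → q ≤ p + r → ∣ p - q ∣ ≤ r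
  ∣p-q∣≤r {p} {q} {r} p≤q+r q≤p+r with ∣p∣≡p∨∣p∣≡-p (p - q)
  ... | inj₁ eq = ≤-trans (≤-reflexive eq) (p≤q+r⇒p-q≤r p q p≤q+r)
  ... | inj₂ eq = ≤-trans (≤-reflexive (trans eq (⁻¹-anti-homo-// +-0-group p q))) (p≤q+r⇒p-q≤r q p q≤p+r)

  -- Both hypotheses, divided by `suc N * suc m`, say that `l / suc N` and `suc j / suc m` differ by
  -- at most `1 / suc N`; the second fraction is the reciprocal of the partition value.
  load-close : ∀ l m j N .{{nz : NonZero (+ suc m / suc j)}} →
               l ℕ.* suc m ℕ.≤ suc N ℕ.* suc j ℕ.+ suc m → suc N ℕ.* suc j ℕ.≤ l ℕ.* suc m ℕ.+ suc m →
               ∣ + l / suc N - 1/ (+ suc m / suc j) ∣ ≤ + 1 / suc N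
  load-close l m j N {{nz}} upper lower =
    subst (λ x → ∣ + l / suc N - x ∣ ≤ + 1 / suc N) (sym (1/-frac m j {{nz}})) (∣p-q∣≤r
    (≤-trans (/-mono-≤ l N (suc j ℕ.* suc N ℕ.+ 1 ℕ.* suc m) (N ℕ.+ m ℕ.* suc N) (begin
       l ℕ.* (suc m ℕ.* suc N)                               ≡⟨ ℕ.*-assoc l _ _ ⟨
       l ℕ.* suc m ℕ.* suc N                                 ≤⟨ ℕ.*-monoˡ-≤ (suc N) upper ⟩
       (suc N ℕ.* suc j ℕ.+ suc m) ℕ.* suc N                  ≡⟨ rearrange₁ (suc N) (suc j) (suc m) ⟩
       (suc j ℕ.* suc N ℕ.+ 1 ℕ.* suc m) ℕ.* suc N            ∎))
     (≤-reflexive (sym (/-+ (suc j) m 1 N))))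
    (≤-trans (/-mono-≤ (suc j) m (l ℕ.* suc N ℕ.+ 1 ℕ.* suc N) (N ℕ.+ N ℕ.* suc N) (begin
       suc j ℕ.* (suc N ℕ.* suc N)                           ≡⟨ rearrange₂ (suc j) (suc N) ⟩
       suc N ℕ.* suc j ℕ.* suc N                             ≤⟨ ℕ.*-monoˡ-≤ (suc N) lower ⟩
       (l ℕ.* suc m ℕ.+ suc m) ℕ.* suc N                      ≡⟨ rearrange₃ l (suc m) (suc N) ⟩
       (l ℕ.* suc N ℕ.+ 1 ℕ.* suc N) ℕ.* suc m                ∎))
     (≤-reflexive (sym (/-+ l N 1 N)))))
    where
    open ℕ.≤-Reasoning
    rearrange₁ : ∀ N j m → (N ℕ.* j ℕ.+ m) ℕ.* N ≡ (j ℕ.* N ℕ.+ 1 ℕ.* m) ℕ.* N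
    rearrange₁ = solve-∀
    rearrange₂ : ∀ j N → j ℕ.* (N ℕ.* N) ≡ N ℕ.* j ℕ.* N
    rearrange₂ = solve-∀
    rearrange₃ : ∀ l m N → (l ℕ.* m ℕ.+ m) ℕ.* N ≡ (l ℕ.* N ℕ.+ 1 ℕ.* N) ℕ.* m
    rearrange₃ = solve-∀

module _ where
  open import Data.Bool.Base using (Bool; true; false; if_then_else_; _∧_)
  open import Data.Empty using (⊥)
  open import Data.Fin.Base using (Fin; zero; suc; punchIn; punchOut)
  open import Data.Fin.Properties
    using (_≟_; all?; nonZeroIndex; injective⇒≤; punchInᵢ≢i; punchOut-injective; punchOut-cong;
           punchOut-punchIn)
  open import Data.Fin.Subset
    using (Subset; inside; outside; _∈_; _∉_; _⊆_; ∣_∣; _∩_) renaming (⊥ to ∅)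
  open import Data.Fin.Subset.Properties
    using (p⊆q⇒∣p∣≤∣q∣; out⊆; s⊆s; _∈?_; _⊆?_; anySubset?; x∈p∩q⁺; x∈p⇒∣p-x∣<∣p∣; ∣⊥∣≡0)
  open import Data.Nat.Base
  open import Data.Nat.Induction using (<-rec)
  open import Data.Nat.Properties as ℕ hiding (_≟_)
  open import Data.Nat.Tactic.RingSolver using (solve-∀)
  open import Data.Product.Base hiding (swap)
  open import Data.Sum.Base using (_⊎_; inj₁; inj₂; [_,_]′)
  open import Data.Vec.Base using (Vec; []; _∷_; lookup; here; there; _[_]≔_; tabulate)
  open import Data.Vec.Functional using (updateAt)
  open import Data.Vec.Functional.Properties using (updateAt-updates; updateAt-minimal)
  open import Data.Vec.Properties
    using ([]=⇒lookup; lookup⇒[]=; lookup∘tabulate; lookup∘update; lookup∘update′; lookup-zipWith)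
  open import Function.Base using (id; _∘_)
  open import Relation.Binary.PropositionalEquality
  open import Relation.Nullary
  open import Relation.Nullary.Decidable
    using (dec-true; decidable-stable; _×-dec_; _→-dec_; ¬?; map′; ¬¬-excluded-middle)
  open import Algebra.Properties.CommutativeMonoid.Sum +-0-commutativeMonoid
    using (sum; sum-cong-≗; ∑-distrib-+; ∑-comm)

  private variable
    n k : ℕ

  -- Finite sums and subsets

  sum-mono : {f g : Fin n → ℕ} → (∀ i → f i ≤ g i) → sum f ≤ sum g
  sum-mono {zero}  f≤g = z≤n
  sum-mono {suc n} f≤g = +-mono-≤ (f≤g zero) (sum-mono (f≤g ∘ suc))

  sum-const : ∀ n c → sum {n} (λ _ → c) ≡ n * c
  sum-const zero    c = refl
  sum-const (suc n) c = cong (c +_) (sum-const n c)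

  *-distribˡ-sum : ∀ c (f : Fin n → ℕ) → c * sum f ≡ sum (λ i → c * f i)
  *-distribˡ-sum {zero}  c f = *-zeroʳ c
  *-distribˡ-sum {suc n} c f =
    trans (*-distribˡ-+ c (f zero) _) (cong (c * f zero +_) (*-distribˡ-sum c (f ∘ suc)))

  term≤sum : ∀ (f : Fin n → ℕ) i → f i ≤ sum f
  term≤sum f zero    = m≤m+n _ _
  term≤sum f (suc i) = ≤-trans (term≤sum (f ∘ suc) i) (m≤n+m _ _)

  -- Subtraction-free bookkeeping for a change in one term. It serves for replacing one tree of a
  -- packing and for sums against `δ`.
  sum-agree : ∀ (f g : Fin n → ℕ) i → (∀ j → j ≢ i → f j ≡ g j) → sum f + g i ≡ sum g + f i
  sum-agree f g zero agree
    rewrite sum-cong-≗ (λ j → agree (suc j) λ ()) = rotate (f zero) (g zero) _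
    where
    rotate : ∀ x y z → x + z + y ≡ y + z + x
    rotate = solve-∀
  sum-agree f g (suc i) agree
    rewrite agree zero (λ ())
          | +-assoc (g zero) (sum (f ∘ suc)) (g (suc i))
          | +-assoc (g zero) (sum (g ∘ suc)) (f (suc i)) =
    cong (g zero +_) (sum-agree (f ∘ suc) (g ∘ suc) i λ j j≢i → agree (suc j) λ { refl → j≢i refl })

  bit : Bool → ℕ
  bit s = if s then 1 else 0

  χ : Subset n → Fin n → ℕ
  χ p x = bit (lookup p x)

  ∣p∣≡sum : (p : Subset n) → ∣ p ∣ ≡ sum (χ p)
  ∣p∣≡sum []          = refl
  ∣p∣≡sum (true ∷ p)  = cong suc (∣p∣≡sum p)
  ∣p∣≡sum (false ∷ p) = ∣p∣≡sum p

  ∈⇒χ : ∀ {p : Subset n} {x} → x ∈ p → χ p x ≡ 1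
  ∈⇒χ x∈p = cong bit ([]=⇒lookup x∈p)

  ∉⇒lookup : ∀ {p : Subset n} {x} → x ∉ p → lookup p x ≡ false
  ∉⇒lookup {p = p} {x} x∉p with lookup p x in eq
  ... | true  = contradiction (lookup⇒[]= x p eq) x∉p
  ... | false = refl

  ∉⇒χ : ∀ {p : Subset n} {x} → x ∉ p → χ p x ≡ 0
  ∉⇒χ x∉p = cong bit (∉⇒lookup x∉p)

  χ-∩ : ∀ (X Y : Subset n) x → χ (X ∩ Y) x ≡ χ Y x * χ X x
  χ-∩ X Y x rewrite lookup-zipWith _∧_ x X Y with lookup X x | lookup Y x
  ... | true  | true  = refl
  ... | true  | false = refl
  ... | false | true  = refl
  ... | false | false = refl

  ∣∩∣ : ∀ (X Y : Subset n) → ∣ X ∩ Y ∣ ≡ sum (λ x → χ Y x * χ X x)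
  ∣∩∣ X Y = trans (∣p∣≡sum (X ∩ Y)) (sum-cong-≗ (χ-∩ X Y))

  ∈⇒0<∣∣ : ∀ {p : Subset n} {x} → x ∈ p → 0 < ∣ p ∣
  ∈⇒0<∣∣ x∈p = ≤-trans (s≤s z≤n) (x∈p⇒∣p-x∣<∣p∣ x∈p)

  δ : Fin n → Fin n → ℕ
  δ x y = bit (does (x ≟ y))

  δ-self : ∀ (x : Fin n) → δ x x ≡ 1
  δ-self x with x ≟ x
  ... | yes _  = refl
  ... | no x≢x = contradiction refl x≢x

  δ-≢ : ∀ {x y : Fin n} → x ≢ y → δ x y ≡ 0
  δ-≢ {x = x} {y} x≢y with x ≟ y
  ... | yes x≡y = contradiction x≡y x≢y
  ... | no _    = refl

  sum-δ : ∀ (x : Fin n) (f : Fin n → ℕ) → sum (λ y → δ x y * f y) ≡ f x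
  sum-δ {n} x f = begin
    sum (λ y → δ x y * f y)            ≡⟨ +-identityʳ _ ⟨
    sum (λ y → δ x y * f y) + 0        ≡⟨ sum-agree _ (λ _ → 0) x agree ⟩
    sum {n} (λ _ → 0) + δ x x * f x    ≡⟨ cong₂ (λ c d → c + d * f x) zeros (δ-self x) ⟩
    f x + 0                            ≡⟨ +-identityʳ _ ⟩
    f x                                ∎
    where
    open ≡-Reasoning
    agree : ∀ y → y ≢ x → δ x y * f y ≡ 0
    agree y y≢x = cong (_* f y) (δ-≢ (y≢x ∘ sym))
    zeros : sum {n} (λ _ → 0) ≡ 0
    zeros = trans (sum-const n 0) (*-zeroʳ n)

  -- Connectivity

  -- Walks in the graph on Fin k whose edges are indexed by Fin n; loops are allowed.
  data Path (a b : Fin n → Fin k) (F : Subset n) : Fin k → Fin k → Set where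
    stop : ∀ {u} → Path a b F u u
    fwd  : ∀ {v} e → e ∈ F → Path a b F (b e) v → Path a b F (a e) v
    bwd  : ∀ {v} e → e ∈ F → Path a b F (a e) v → Path a b F (b e) v

  module _ {a b : Fin n → Fin k} {F : Subset n} where

    _++_ : ∀ {u v w} → Path a b F u v → Path a b F v w → Path a b F u w
    stop      ++ q = q
    fwd e m p ++ q = fwd e m (p ++ q)
    bwd e m p ++ q = bwd e m (p ++ q)

    reverse : ∀ {u v} → Path a b F u v → Path a b F v u
    reverse stop        = stop
    reverse (fwd e m p) = reverse p ++ bwd e m stop
    reverse (bwd e m p) = reverse p ++ fwd e m stop

    edge : ∀ {e} → e ∈ F → Path a b F (a e) (b e)
    edge m = fwd _ m stop

    path-invariant : ∀ {A : Set} (f : Fin k → A) → (∀ {e} → e ∈ F → f (a e) ≡ f (b e)) →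
                     ∀ {u v} → Path a b F u v → f u ≡ f v
    path-invariant f inv stop        = refl
    path-invariant f inv (fwd e m p) = trans (inv m) (path-invariant f inv p)
    path-invariant f inv (bwd e m p) = trans (sym (inv m)) (path-invariant f inv p)

  bind : ∀ {n n′ k} {a b : Fin n → Fin k} {a′ b′ : Fin n′ → Fin k} {F F′} →
         (∀ {e} → e ∈ F → Path a′ b′ F′ (a e) (b e)) →
         ∀ {u v} → Path a b F u v → Path a′ b′ F′ u v
  bind f stop        = stop
  bind f (fwd e m p) = f m ++ bind f p
  bind f (bwd e m p) = reverse (f m) ++ bind f p

  weaken : ∀ {a b : Fin n → Fin k} {F F′ : Subset n} → F ⊆ F′ →
           ∀ {u v} → Path a b F u v → Path a b F′ u v
  weaken F⊆F′ = bind (edge ∘ F⊆F′)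

  -- `closed` and `join` together make equality of labels the same as connectivity in `F`.
  -- `forest-size` is the rank formula for a spanning forest, with the number of components moved to
  -- the other side.
  record Components (a b : Fin n → Fin k) (F : Subset n) : Set where
    field
      count    : ℕ
      label    : Fin k → Fin count
      onto     : ∀ i → ∃[ v ] label v ≡ i
      forest   : Subset n
      forest⊆F : forest ⊆ F
      forest-size : ∣ forest ∣ + count ≡ k
      join     : ∀ {u v} → label u ≡ label v → Path a b forest u v
      closed   : ∀ {e} → e ∈ F → label (a e) ≡ label (b e)

    label-cong : ∀ {u v} → Path a b F u v → label u ≡ label v
    label-cong = path-invariant label closed

  -- Identification of two labels; `fibres` states that no other labels are identified.
  record Merge {c} (i j : Fin c) : Set where
    field
      count   : ℕ
      count+1 : suc count ≡ c
      merge   : Fin c → Fin count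
      section : ∀ y → ∃[ x ] merge x ≡ y
      merged  : merge i ≡ merge j
      fibres  : ∀ {x y} → merge x ≡ merge y → x ≡ y ⊎ (x ≡ i × y ≡ j) ⊎ (x ≡ j × y ≡ i)

  -- `punchOut` closes the gap left by `j`, and `j` itself is sent to the image of `i`.
  merge-labels : ∀ {c} {i j : Fin c} → i ≢ j → Merge i j
  merge-labels {suc c} {i} {j} i≢j = record
    { count = c ; count+1 = refl ; merge = merge
    ; section = λ y → punchIn j y , section y
    ; merged = merged ; fibres = fibres }
    where
    j≢i : j ≢ i
    j≢i = i≢j ∘ sym
    merge : Fin (suc c) → Fin c
    merge x with j ≟ x
    ... | yes _  = punchOut j≢i
    ... | no j≢x = punchOut j≢x
    section : ∀ y → merge (punchIn j y) ≡ y
    section y with j ≟ punchIn j y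
    ... | yes j≡ = contradiction (sym j≡) (punchInᵢ≢i j y)
    ... | no j≢  = trans (punchOut-cong j refl) (punchOut-punchIn j)
    merged : merge i ≡ merge j
    merged with j ≟ i | j ≟ j
    ... | yes j≡i | _      = contradiction j≡i j≢i
    ... | no _    | no j≢j = contradiction refl j≢j
    ... | no j≢i  | yes _  = punchOut-cong j refl
    fibres : ∀ {x y} → merge x ≡ merge y → x ≡ y ⊎ (x ≡ i × y ≡ j) ⊎ (x ≡ j × y ≡ i)
    fibres {x} {y} eq with j ≟ x | j ≟ y
    ... | yes j≡x | yes j≡y = inj₁ (trans (sym j≡x) j≡y)
    ... | yes j≡x | no j≢y  = inj₂ (inj₂ (sym j≡x , sym (punchOut-injective j≢i j≢y eq)))
    ... | no j≢x  | yes j≡y = inj₂ (inj₁ (punchOut-injective j≢x j≢i eq , sym j≡y))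
    ... | no j≢x  | no j≢y  = inj₁ (punchOut-injective j≢x j≢y eq)

  -- As in Kruskal's algorithm, edges are added one at a time: an edge enters the forest exactly
  -- when its ends still have different labels, which are then merged.
  components : (a b : Fin n → Fin k) (F : Subset n) → Components a b F
  components {zero} {k} a b [] = record
    { count = k ; label = id ; onto = λ i → i , refl ; forest = [] ; forest⊆F = λ ()
    ; forest-size = refl ; join = λ { refl → stop } ; closed = λ () }
  components {suc n} a b (s ∷ F) = add s
    where
    open Components (components (a ∘ suc) (b ∘ suc) F)
    shift : ∀ {t u v} → Path (a ∘ suc) (b ∘ suc) forest u v → Path a b (t ∷ forest) u v
    shift = bind (λ m → edge (there m))
    add : ∀ s → Components a b (s ∷ F)
    add outside = record
      { count = count ; label = label ; onto = onto ; forest = outside ∷ forest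
      ; forest⊆F = s⊆s forest⊆F ; forest-size = forest-size ; join = shift ∘ join
      ; closed = λ { (there m) → closed m } }
    add inside with label (a zero) ≟ label (b zero)
    ... | yes eq = record
      { count = count ; label = label ; onto = onto ; forest = outside ∷ forest
      ; forest⊆F = out⊆ forest⊆F ; forest-size = forest-size ; join = shift ∘ join
      ; closed = λ { here → eq ; (there m) → closed m } }
    ... | no neq = record
      { count = M.count ; label = M.merge ∘ label
      ; onto = λ i → let x , x↦i = M.section i ; v , v↦x = onto x in v , trans (cong M.merge v↦x) x↦i
      ; forest = inside ∷ forest ; forest⊆F = s⊆s forest⊆F
      ; forest-size = trans (sym (+-suc _ _)) (trans (cong (∣ forest ∣ +_) M.count+1) forest-size)
      ; join = join′ ∘ M.fibres
      ; closed = λ { here → M.merged ; (there m) → cong M.merge (closed m) } }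
      where
      module M = Merge (merge-labels neq)
      join′ : ∀ {u v} → label u ≡ label v ⊎
              (label u ≡ label (a zero) × label v ≡ label (b zero)) ⊎
              (label u ≡ label (b zero) × label v ≡ label (a zero)) →
              Path a b (inside ∷ forest) u v
      join′ (inj₁ eq)                = shift (join eq)
      join′ (inj₂ (inj₁ (eqᵤ , eqᵥ))) = shift (join eqᵤ) ++ fwd zero here (shift (join (sym eqᵥ)))
      join′ (inj₂ (inj₂ (eqᵤ , eqᵥ))) = shift (join eqᵤ) ++ bwd zero here (shift (join (sym eqᵥ)))

  path? : (a b : Fin n → Fin k) (F : Subset n) (u v : Fin k) → Dec (Path a b F u v)
  path? a b F u v = map′ (weaken forest⊆F ∘ join) label-cong (label u ≟ label v)
    where open Components (components a b F)

  -- Representatives of different components of `F` have different values of `lab`, so there are at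
  -- most `q` components, and the spanning forest already has enough edges.
  connecting-size : ∀ {a b : Fin n → Fin k} {F : Subset n} {q} (lab : Fin k → Fin q) →
                    (∀ i → ∃[ v ] lab v ≡ i) →
                    (∀ {u v} → lab u ≡ lab v → Path a b F u v) → k ≤ ∣ F ∣ + q
  connecting-size {k = k} {a = a} {b} {F} {q} lab onto′ joined = begin
    k                 ≡⟨ forest-size ⟨
    ∣ forest ∣ + count ≤⟨ +-mono-≤ (p⊆q⇒∣p∣≤∣q∣ forest⊆F) (injective⇒≤ inj) ⟩
    ∣ F ∣ + q          ∎
    where
    open ≤-Reasoning
    open Components (components a b F)
    rep : Fin count → Fin k
    rep i = proj₁ (onto i)
    inj : ∀ {i j} → lab (rep i) ≡ lab (rep j) → i ≡ j
    inj {i} {j} eq = trans (sym (proj₂ (onto i))) (trans (label-cong (joined eq)) (proj₂ (onto j)))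

  -- Well-founded descent on the value of `μ`. For an arbitrary type the minimiser exists only up to
  -- double negation, which is enough for decidable goals.
  least : ∀ {A : Set} (μ : A → ℕ) → A → ¬ ¬ (∃[ x ] ∀ y → μ x ≤ μ y)
  least {A} μ x none = <-rec (λ m → ∀ x → μ x ≡ m → ⊥) descend (μ x) x refl
    where
    descend : ∀ m → (∀ {m′} → m′ < m → ∀ x → μ x ≡ m′ → ⊥) → ∀ x → μ x ≡ m → ⊥
    descend _ rec x refl = none (x , λ y → ≮⇒≥ λ μy<μx → rec μy<μx y refl)

  -- Double-negation shift, which holds because the index set is finite.
  ¬¬-all : ∀ {P : Fin n → Set} → (∀ i → ¬ ¬ P i) → ¬ ¬ (∀ i → P i)
  ¬¬-all {zero}  ps none = none λ ()
  ¬¬-all {suc n} ps none =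
    ps zero λ p₀ → ¬¬-all (ps ∘ suc) λ p → none λ { zero → p₀ ; (suc i) → p i }

  module _ {P : Fin n → Set} where

    ⟦_⟧ : (∀ x → Dec (P x)) → Subset n
    ⟦ P? ⟧ = tabulate (does ∘ P?)

    ∈⟦⟧⁺ : ∀ P? {x} → P x → x ∈ ⟦ P? ⟧
    ∈⟦⟧⁺ P? {x} px = lookup⇒[]= x _ (trans (lookup∘tabulate _ x) (dec-true (P? x) px))

    ∈⟦⟧⁻ : ∀ P? {x} → x ∈ ⟦ P? ⟧ → P x
    ∈⟦⟧⁻ P? {x} x∈ with P? x | trans (sym (lookup∘tabulate (does ∘ P?) x)) ([]=⇒lookup x∈)
    ... | yes px | _ = px

  -- Exchanging edges of spanning trees

  remove : Subset n → Fin n → Subset n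
  remove F e = F [ e ]≔ outside

  ∈-remove⁺ : ∀ {F : Subset n} {e x} → x ∈ F → x ≢ e → x ∈ remove F e
  ∈-remove⁺ {F = F} {e} {x} x∈F x≢e =
    lookup⇒[]= x _ (trans (lookup∘update′ x≢e F outside) ([]=⇒lookup x∈F))

  ∈-remove⁻ : ∀ {F : Subset n} {e x} → x ∈ remove F e → x ∈ F × x ≢ e
  ∈-remove⁻ {F = F} {e} {x} x∈ with x ≟ e
  ... | no x≢e = lookup⇒[]= x F (trans (sym (lookup∘update′ x≢e F outside)) ([]=⇒lookup x∈)) , x≢e
  ... | yes refl with () ← trans (sym (lookup∘update x F outside)) ([]=⇒lookup x∈)

  ∣remove∣ : ∀ {F : Subset n} {e} → e ∈ F → suc ∣ remove F e ∣ ≡ ∣ F ∣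
  ∣remove∣ {F = inside ∷ F}  here       = refl
  ∣remove∣ {F = inside ∷ F}  (there e∈) = cong suc (∣remove∣ e∈)
  ∣remove∣ {F = outside ∷ F} (there e∈) = ∣remove∣ e∈

  exchange : Subset n → Fin n → Fin n → Subset n
  exchange F e f = remove F e [ f ]≔ inside

  module _ {F : Subset n} {e f : Fin n} where

    f∈exchange : f ∈ exchange F e f
    f∈exchange = lookup⇒[]= f _ (lookup∘update f (remove F e) inside)

    ∈-exchange⁺ : ∀ {x} → x ∈ F → x ≢ e → x ∈ exchange F e f
    ∈-exchange⁺ {x} x∈F x≢e with x ≟ f
    ... | yes refl = f∈exchange
    ... | no x≢f   = lookup⇒[]= x _
      (trans (lookup∘update′ x≢f (remove F e) inside) ([]=⇒lookup (∈-remove⁺ x∈F x≢e)))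

    ∈-exchange⁻ : ∀ {x} → x ∈ exchange F e f → x ≡ f ⊎ x ∈ F
    ∈-exchange⁻ {x} x∈ with x ≟ f
    ... | yes x≡f = inj₁ x≡f
    ... | no x≢f  = inj₂ (proj₁ (∈-remove⁻ (lookup⇒[]= x (remove F e)
      (trans (sym (lookup∘update′ x≢f (remove F e) inside)) ([]=⇒lookup x∈)))))

    χ-exchange : e ∈ F → f ∉ F → ∀ x → χ (exchange F e f) x + δ e x ≡ χ F x + δ f x
    χ-exchange e∈F f∉F x with x ≟ f
    ... | yes refl = trans (cong₂ _+_ (∈⇒χ f∈exchange) (δ-≢ {x = e} λ { refl → f∉F e∈F }))
                       (sym (cong₂ _+_ (∉⇒χ f∉F) (δ-self f)))
    ... | no x≢f with x ≟ e
    ...   | yes refl = trans (cong₂ _+_ (trans (cong bit (lookup∘update′ x≢f (remove F x) inside))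
                                          (cong bit (lookup∘update x F outside))) (δ-self x))
                       (sym (cong₂ _+_ (∈⇒χ e∈F) (δ-≢ (x≢f ∘ sym))))
    ...   | no x≢e = cong₂ _+_ (trans (cong bit (lookup∘update′ x≢f (remove F e) inside))
                                  (cong bit (lookup∘update′ x≢e F outside)))
                       (trans (δ-≢ (x≢e ∘ sym)) (sym (δ-≢ (x≢f ∘ sym))))

    ∣exchange∣ : e ∈ F → f ∉ F → ∣ exchange F e f ∣ ≡ ∣ F ∣
    ∣exchange∣ e∈F f∉F = +-cancelʳ-≡ 1 _ _ (begin
      ∣ exchange F e f ∣ + 1                      ≡⟨ cong₂ _+_ (∣p∣≡sum (exchange F e f)) (sym (sum-δ₁ e)) ⟩
      sum (χ (exchange F e f)) + sum (δ e)        ≡⟨ ∑-distrib-+ (χ (exchange F e f)) (δ e) ⟨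
      sum (λ x → χ (exchange F e f) x + δ e x)    ≡⟨ sum-cong-≗ (χ-exchange e∈F f∉F) ⟩
      sum (λ x → χ F x + δ f x)                   ≡⟨ ∑-distrib-+ (χ F) (δ f) ⟩
      sum (χ F) + sum (δ f)                       ≡⟨ cong₂ _+_ (sym (∣p∣≡sum F)) (sum-δ₁ f) ⟩
      ∣ F ∣ + 1                                   ∎)
      where
      open ≡-Reasoning
      sum-δ₁ : ∀ (x : Fin n) → sum (δ x) ≡ 1
      sum-δ₁ x = trans (sum-cong-≗ λ y → sym (*-identityʳ (δ x y))) (sum-δ x (λ _ → 1))

  module _ {a b : Fin n → Fin k} where

    -- Keep the walk before its first and after its last use of `e`. If these two pieces meet `e` at
    -- the same end, they combine to a walk avoiding `e`; otherwise they attach to opposite ends, in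
    -- one of two orders.
    detour : ∀ {F u v} e → Path a b F u v → let F-e = remove F e in
             Path a b F-e u v ⊎
             (Path a b F-e u (a e) × Path a b F-e (b e) v) ⊎
             (Path a b F-e u (b e) × Path a b F-e (a e) v)
    detour e stop = inj₁ stop
    detour e (fwd x m p) with x ≟ e | detour e p
    ... | yes refl | inj₁ q                = inj₂ (inj₁ (stop , q))
    ... | yes refl | inj₂ (inj₁ (_ , r))   = inj₂ (inj₁ (stop , r))
    ... | yes refl | inj₂ (inj₂ (_ , r))   = inj₁ r
    ... | no x≢e   | inj₁ q                = inj₁ (fwd x (∈-remove⁺ m x≢e) q)
    ... | no x≢e   | inj₂ (inj₁ (q , r))   = inj₂ (inj₁ (fwd x (∈-remove⁺ m x≢e) q , r))
    ... | no x≢e   | inj₂ (inj₂ (q , r))   = inj₂ (inj₂ (fwd x (∈-remove⁺ m x≢e) q , r))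
    detour e (bwd x m p) with x ≟ e | detour e p
    ... | yes refl | inj₁ q                = inj₂ (inj₂ (stop , q))
    ... | yes refl | inj₂ (inj₁ (_ , r))   = inj₁ r
    ... | yes refl | inj₂ (inj₂ (_ , r))   = inj₂ (inj₂ (stop , r))
    ... | no x≢e   | inj₁ q                = inj₁ (bwd x (∈-remove⁺ m x≢e) q)
    ... | no x≢e   | inj₂ (inj₁ (q , r))   = inj₂ (inj₁ (bwd x (∈-remove⁺ m x≢e) q , r))
    ... | no x≢e   | inj₂ (inj₂ (q , r))   = inj₂ (inj₂ (bwd x (∈-remove⁺ m x≢e) q , r))

    -- The edge set of a simple path, encoded as a joining set from which no edge can be deleted.
    record Connector (F : Subset n) (u v : Fin k) : Set where
      field
        path    : Subset n
        path⊆F  : path ⊆ F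
        joins   : Path a b path u v
        minimal : ∀ {e} → e ∈ path → ¬ Path a b (remove path e) u v

    connector : ∀ {F u v} → Path a b F u v → ¬ ¬ Connector F u v
    connector {F} {u} {v} p none =
      least {A = ∃[ P ] P ⊆ F × Path a b P u v} (∣_∣ ∘ proj₁) (F , id , p)
        λ ((P , P⊆F , joins) , smallest) → none record
          { path = P ; path⊆F = P⊆F ; joins = joins
          ; minimal = λ {e} e∈P q → <-irrefl refl (≤-trans (≤-reflexive (∣remove∣ e∈P))
              (smallest (remove P e , P⊆F ∘ proj₁ ∘ ∈-remove⁻ , q))) }

    -- The edge `f` closes a cycle with the connector, so a walk using `e` can go around this cycle
    -- the other way. Minimality of the connector guarantees that `e` separates the ends of `f` on
    -- it.
    exchange-connects : ∀ {T e f} (c : Connector T (a f) (b f)) → e ∈ Connector.path c →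
                        ∀ {u v} → Path a b T u v → Path a b (exchange T e f) u v
    exchange-connects {T} {e} {f} c e∈P = bind λ {x} x∈T → bridge x x∈T (x ≟ e)
      where
      open Connector c
      P-e⊆ : remove path e ⊆ exchange T e f
      P-e⊆ x∈ = let x∈P , x≢e = ∈-remove⁻ x∈ in ∈-exchange⁺ (path⊆F x∈P) x≢e
      around : Path a b (exchange T e f) (a e) (b e)
      around with detour e joins
      ... | inj₁ q              = contradiction q (minimal e∈P)
      ... | inj₂ (inj₁ (q , r)) = reverse (weaken P-e⊆ q) ++ (fwd f f∈exchange (reverse (weaken P-e⊆ r)))
      ... | inj₂ (inj₂ (q , r)) = weaken P-e⊆ r ++ bwd f f∈exchange (weaken P-e⊆ q)
      bridge : ∀ x → x ∈ T → Dec (x ≡ e) → Path a b (exchange T e f) (a x) (b x)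
      bridge x x∈T (yes refl) = around
      bridge x x∈T (no x≢e)   = edge (∈-exchange⁺ x∈T x≢e)

  -- Loads, their sum of squares, and the tree predicate.

  edgeLoad : ∀ {N} → (Fin N → Subset n) → Fin n → ℕ
  edgeLoad T x = sum (λ i → χ (T i) x)

  replace : ∀ {N} → (Fin N → Subset n) → Fin N → Subset n → Fin N → Subset n
  replace T i F = updateAt T i (λ _ → F)

  edgeLoad-replace : ∀ {N} (T : Fin N → Subset n) i F x →
                 edgeLoad (replace T i F) x + χ (T i) x ≡ edgeLoad T x + χ F x
  edgeLoad-replace T i F x = trans
    (sum-agree (λ j → χ (replace T i F j) x) (λ j → χ (T j) x) i
      λ j j≢i → cong (λ X → χ X x) (updateAt-minimal j i T j≢i))
    (cong (λ X → edgeLoad T x + χ X x) (updateAt-updates i T))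

  energy : ∀ {N} → (Fin N → Subset n) → ℕ
  energy T = sum (λ x → edgeLoad T x * edgeLoad T x)

  square-step : ∀ s l → l * l + bit s * (2 * l + 1) ≡ (l + bit s) * (l + bit s)
  square-step false = solve-∀
  square-step true  = solve-∀

  -- Squaring and summing both sides of the transfer equation reduces the claim to `L f < L′ e`.
  -- Since `L′ e` is one less than `L e`, a gap of two makes this strict.
  transfer-lowers-squares : ∀ {L L′ : Fin n → ℕ} {e f} → (∀ x → L′ x + δ e x ≡ L x + δ f x) →
                            2 + L f ≤ L e → sum (λ x → L′ x * L′ x) < sum (λ x → L x * L x)
  transfer-lowers-squares {n = n} {L} {L′} {e} {f} transfer gap = ≰⇒> λ ΣL²≤ΣL′² →
    <-irrefl (sym balance) (+-mono-≤-< ΣL²≤ΣL′² (+-monoˡ-< 1 (*-monoʳ-< 2 Lf<L′e)))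
    where
    open ≡-Reasoning
    weighted : (Fin n → ℕ) → Fin n → ℕ
    weighted M x = sum (λ y → δ x y * (2 * M y + 1))
    expand : ∀ M x → sum (λ y → M y * M y) + (2 * M x + 1) ≡ sum (λ y → (M y + δ x y) * (M y + δ x y))
    expand M x = begin
      sum (λ y → M y * M y) + (2 * M x + 1)                ≡⟨ cong (_ +_) (sum-δ x (λ y → 2 * M y + 1)) ⟨
      sum (λ y → M y * M y) + weighted M x
        ≡⟨ ∑-distrib-+ (λ y → M y * M y) (λ y → δ x y * (2 * M y + 1)) ⟨
      sum (λ y → M y * M y + δ x y * (2 * M y + 1))
        ≡⟨ sum-cong-≗ (λ y → square-step (does (x ≟ y)) (M y)) ⟩
      sum (λ y → (M y + δ x y) * (M y + δ x y))            ∎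
    balance : sum (λ x → L′ x * L′ x) + (2 * L′ e + 1) ≡ sum (λ x → L x * L x) + (2 * L f + 1)
    balance = begin
      sum (λ x → L′ x * L′ x) + (2 * L′ e + 1)  ≡⟨ expand L′ e ⟩
      sum (λ y → (L′ y + δ e y) * (L′ y + δ e y)) ≡⟨ sum-cong-≗ (λ y → cong (λ z → z * z) (transfer y)) ⟩
      sum (λ y → (L y + δ f y) * (L y + δ f y)) ≡⟨ expand L f ⟨
      sum (λ x → L x * L x) + (2 * L f + 1)     ∎
    f≢e : f ≢ e
    f≢e refl = <-irrefl refl (≤-trans (n≤1+n _) gap)
    Lf<L′e : L f < L′ e
    Lf<L′e = +-cancelʳ-≤ 1 _ _ (≤-trans (≤-reflexive (+-comm _ 1)) (≤-trans gap (≤-reflexive (begin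
      L e             ≡⟨ +-identityʳ _ ⟨
      L e + 0         ≡⟨ cong (L e +_) (δ-≢ f≢e) ⟨
      L e + δ f e     ≡⟨ transfer e ⟨
      L′ e + δ e e    ≡⟨ cong (L′ e +_) (δ-self e) ⟩
      L′ e + 1        ∎))))

  -- A connected graph on `p + 1` vertices with `p` edges is a tree; this form is decidable and
  -- easily checked after an exchange. `D` is the set of edges allowed, for a quotient its crossing
  -- edges.
  record IsTree {p} (a b : Fin n → Fin (suc p)) (D F : Subset n) : Set where
    field
      F⊆D       : F ⊆ D
      connected : ∀ u v → Path a b F u v
      tree-size : ∣ F ∣ ≡ p

  isTree? : ∀ {p} (a b : Fin n → Fin (suc p)) D F → Dec (IsTree a b D F)
  isTree? {p = p} a b D F = map′
    (λ (F⊆D , connected , tree-size) → record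
      { F⊆D = λ {x} → F⊆D {x} ; connected = connected ; tree-size = tree-size })
    (λ t → (λ {x} → IsTree.F⊆D t {x}) , IsTree.connected t , IsTree.tree-size t)
    (F ⊆? D ×-dec all? (λ u → all? (path? a b F u)) ×-dec (∣ F ∣ ℕ.≟ p))

  -- Token moves between spanning trees.

  module _ {p} (a b : Fin n → Fin (suc p)) (D : Subset n) where

    exchange-tree : ∀ {T e f} → IsTree a b D T → (c : Connector {a = a} {b} T (a f) (b f)) →
                    e ∈ Connector.path c → f ∈ D → f ∉ T → IsTree a b D (exchange T e f)
    exchange-tree t c e∈P f∈D f∉T = record
      { F⊆D       = λ x∈ → [ (λ { refl → f∈D }) , F⊆D ]′ (∈-exchange⁻ x∈)
      ; connected = λ u v → exchange-connects c e∈P (connected u v)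
      ; tree-size = trans (∣exchange∣ (Connector.path⊆F c e∈P) f∉T) tree-size }
      where open IsTree t

    module _ {N} (T₀ : Fin N → Subset n) (trees : ∀ i → IsTree a b D (T₀ i)) where

      -- A token travels through the edges: a step replaces the edge e under it by f in one of the
      -- trees and moves the token to f.  Thus T has the loads of T₀, except that one unit has been
      -- moved from e₀ to the edge under the token.
      data Reach (e₀ : Fin n) : (Fin N → Subset n) → Fin n → Set where
        start : Reach e₀ T₀ e₀
        move  : ∀ {T e} i f → Reach e₀ T e → e ∈ T i → f ∉ T i →
                IsTree a b D (exchange (T i) e f) → Reach e₀ (replace T i (exchange (T i) e f)) f

      reach-trees : ∀ {e₀ T e} → Reach e₀ T e → ∀ i → IsTree a b D (T i)
      reach-trees start i = trees i
      reach-trees (move {T} i f r _ _ t) j with j ≟ i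
      ... | yes refl = subst (IsTree a b D) (sym (updateAt-updates i T)) t
      ... | no j≢i   = subst (IsTree a b D) (sym (updateAt-minimal j i T j≢i)) (reach-trees r j)

      reach-load : ∀ {e₀ T e} → Reach e₀ T e → ∀ x → edgeLoad T x + δ e₀ x ≡ edgeLoad T₀ x + δ e x
      reach-load start x = refl
      reach-load {e₀} (move {T} {e} i f r e∈T f∉T _) x =
        cancel (edgeLoad (replace T i (exchange (T i) e f)) x) (χ (T i) x) (edgeLoad T x)
               (χ (exchange (T i) e f) x) (δ e x) (δ f x) (edgeLoad T₀ x) (δ e₀ x)
               (edgeLoad-replace T i (exchange (T i) e f) x) (χ-exchange e∈T f∉T x) (reach-load r x)
        where
        cancel : ∀ l′ t l t′ de df l₀ d₀ → l′ + t ≡ l + t′ → t′ + de ≡ t + df → l + d₀ ≡ l₀ + de →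
                 l′ + d₀ ≡ l₀ + df
        cancel l′ t l t′ de df l₀ d₀ eq₁ eq₂ eq₃ =
          +-cancelʳ-≡ (t + (de + t′ + l)) _ _ (begin
            l′ + d₀ + (t + (de + t′ + l))     ≡⟨ lhs l′ t l t′ de d₀ ⟩
            (l′ + t) + (t′ + de) + (l + d₀)   ≡⟨ cong₂ _+_ (cong₂ _+_ eq₁ eq₂) eq₃ ⟩
            (l + t′) + (t + df) + (l₀ + de)   ≡⟨ rhs l t l₀ t′ de df ⟩
            l₀ + df + (t + (de + t′ + l))     ∎)
          where
          open ≡-Reasoning
          lhs : ∀ l′ t l t′ de d₀ → l′ + d₀ + (t + (de + t′ + l)) ≡ (l′ + t) + (t′ + de) + (l + d₀)
          lhs = solve-∀
          rhs : ∀ l t l₀ t′ de df → (l + t′) + (t + df) + (l₀ + de) ≡ l₀ + df + (t + (de + t′ + l))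
          rhs = solve-∀

      Reachable : (Fin n → Set) → Fin n → Set
      Reachable Start x = ∃[ e₀ ] Start e₀ × ∃[ T ] Reach e₀ T x

      -- If f is unreachable, then so is every edge of its path P in T₀ i: no token ever lies on P,
      -- since it could step from there to f, and therefore P survives all exchanges.
      joined-by-unreachable : ∀ {Start f K} → f ∈ D → ¬ Reachable Start f →
                              (∀ {x} → x ∈ D → ¬ Reachable Start x → x ∈ K) →
                              ∀ i → Path a b (T₀ i ∩ K) (a f) (b f)
      joined-by-unreachable {Start} {f} {K} f∈D f-unreachable K⊇ i with f ∈? T₀ i
      ... | yes f∈T₀ = edge (x∈p∩q⁺ (f∈T₀ , K⊇ f∈D f-unreachable))
      -- The connector is available only under double negation, but connectivity is decidable.
      ... | no f∉T₀  = decidable-stable (path? a b _ _ _) λ none →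
        connector (IsTree.connected (trees i) (a f) (b f)) λ c → none (path-survives c)
        where
        module _ (c : Connector {a = a} {b} (T₀ i) (a f) (b f)) where
          open Connector c
          off-path : ∀ {e₀ T e} → Start e₀ → Reach e₀ T e → path ⊆ T i → f ∉ T i → e ∉ path
          off-path {e₀} {T} {e} s r P⊆T f∉T e∈P = f-unreachable (e₀ , s , _ , move i f r (P⊆T e∈P) f∉T
            (exchange-tree (reach-trees r i)
              (record { path = path ; path⊆F = P⊆T ; joins = joins ; minimal = minimal }) e∈P f∈D f∉T))
          invariant : ∀ {e₀ T e} → Start e₀ → Reach e₀ T e → path ⊆ T i × f ∉ T i
          invariant s start = path⊆F , f∉T₀
          invariant s r′@(move {T} {e} j g r e∈T g∉T t) with invariant s r | i ≟ j
          ... | P⊆T , f∉T | no i≢j rewrite updateAt-minimal i j {λ _ → exchange (T j) e g} T i≢j =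
            P⊆T , f∉T
          -- This exchange removes `e`, which is off the path, and inserts `g`, which is reachable
          -- and hence different from `f`.
          ... | P⊆T , f∉T | yes refl rewrite updateAt-updates i {λ _ → exchange (T i) e g} T =
            (λ x∈P → ∈-exchange⁺ (P⊆T x∈P) λ { refl → off-path s r P⊆T f∉T x∈P }) ,
            λ f∈ → [ (λ { refl → f-unreachable (_ , s , _ , r′) }) , f∉T ]′ (∈-exchange⁻ f∈)
          path-survives : Path a b (T₀ i ∩ K) (a f) (b f)
          path-survives = weaken (λ x∈P → x∈p∩q⁺ (path⊆F x∈P , K⊇ (IsTree.F⊆D (trees i) (path⊆F x∈P))
            λ (e₀ , s , T , r) → let P⊆T , f∉T = invariant s r in off-path s r P⊆T f∉T x∈P)) joins

    reachable-in-D : ∀ {N} {T₀ : Fin N → Subset n} {trees} {e₀ T x} → e₀ ∈ D → Reach T₀ trees e₀ T x → x ∈ D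
    reachable-in-D e₀∈D start = e₀∈D
    reachable-in-D e₀∈D (move i f _ _ _ t) = IsTree.F⊆D t f∈exchange

    -- Packings of minimum energy and their cuts.

    Packing : ℕ → Set
    Packing N = Σ[ T ∈ (Fin N → Subset n) ] ∀ i → IsTree a b D (T i)

    -- A split of `D` at load `s`; edges of load exactly `s` may lie on either side. `cover` encodes
    -- that `R` and `K` partition `D`, and by `K-spanned` each tree spans every component of `K`
    -- using edges of `K`.
    record Cut {N} (T : Fin N → Subset n) (s : ℕ) : Set where
      field
        R K       : Subset n
        cover     : ∀ x → χ R x + χ K x ≡ χ D x
        heavy     : ∀ {x} → x ∈ R → s ≤ edgeLoad T x
        light     : ∀ {x} → x ∈ K → edgeLoad T x ≤ s
        heavier∈R : ∀ {x} → x ∈ D → s < edgeLoad T x → x ∈ R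
        lighter∈K : ∀ {x} → x ∈ D → edgeLoad T x < s → x ∈ K
        K-spanned : ∀ i {f} → f ∈ K → Path a b (T i ∩ K) (a f) (b f)

    cut : ∀ {N} ((T , trees) : Packing N) → (∀ (T′ : Packing N) → energy T ≤ energy (proj₁ T′)) →
          ∀ s → ¬ ¬ Cut T s
    -- Under double negation, reachability may be taken to be decidable for all of the finitely many
    -- edges at once.
    cut (T , trees) optimal s none = ¬¬-all {P = λ x → Dec (Reachable T trees Start x)}
      (λ x → ¬¬-excluded-middle) λ reach? → none (build reach?)
      where
      Start : Fin _ → Set
      Start e = e ∈ D × s < edgeLoad T e
      -- Reaching an edge lighter than `s` would move one unit of load across a gap of at least two
      -- and so lower the energy.
      heavy′ : ∀ {x} → Reachable T trees Start x → s ≤ edgeLoad T x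
      heavy′ {x} (e₀ , (e₀∈D , s<e₀) , T′ , r) = ≮⇒≥ λ x<s →
        <⇒≱ (transfer-lowers-squares {L = edgeLoad T} {edgeLoad T′} (reach-load T trees r)
              (≤-trans (s≤s x<s) s<e₀))
            (optimal (T′ , reach-trees T trees r))
      build : (∀ x → Dec (Reachable T trees Start x)) → Cut T s
      build reach? = record
        { R = ⟦ reach? ⟧ ; K = ⟦ rest? ⟧ ; cover = cover
        ; heavy = heavy′ ∘ ∈⟦⟧⁻ reach?
        ; light = λ x∈K → let x∈D , unreachable = ∈⟦⟧⁻ rest? x∈K in
            ≮⇒≥ λ s<x → unreachable (_ , (x∈D , s<x) , _ , start)
        ; heavier∈R = λ x∈D s<x → ∈⟦⟧⁺ reach? (_ , (x∈D , s<x) , _ , start)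
        ; lighter∈K = λ x∈D x<s → ∈⟦⟧⁺ rest? (x∈D , λ r → <⇒≱ x<s (heavy′ r))
        ; K-spanned = λ i f∈K → let f∈D , unreachable = ∈⟦⟧⁻ rest? f∈K in
            joined-by-unreachable T trees f∈D unreachable (λ x∈D ¬r → ∈⟦⟧⁺ rest? (x∈D , ¬r)) i }
        where
        rest? : ∀ x → Dec (x ∈ D × ¬ Reachable T trees Start x)
        rest? x = (x ∈? D) ×-dec ¬? (reach? x)
        cover : ∀ x → χ ⟦ reach? ⟧ x + χ ⟦ rest? ⟧ x ≡ χ D x
        cover x with x ∈? D
        ... | no x∉D  = trans (cong₂ _+_ (∉⇒χ {p = ⟦ reach? ⟧} λ x∈ → x∉D (inD (∈⟦⟧⁻ reach? x∈)))
                                         (∉⇒χ {p = ⟦ rest? ⟧} (x∉D ∘ proj₁ ∘ ∈⟦⟧⁻ rest?))) (sym (∉⇒χ x∉D))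
          where
          inD : Reachable T trees Start x → x ∈ D
          inD (_ , (e₀∈D , _) , _ , r) = reachable-in-D e₀∈D r
        ... | yes x∈D with reach? x
        ...   | yes r = trans (cong₂ _+_ (∈⇒χ (∈⟦⟧⁺ reach? r))
                                         (∉⇒χ {p = ⟦ rest? ⟧} λ x∈ → proj₂ (∈⟦⟧⁻ rest? x∈) r))
                              (sym (∈⇒χ x∈D))
        ...   | no ¬r = trans (cong₂ _+_ (∉⇒χ {p = ⟦ reach? ⟧} (¬r ∘ ∈⟦⟧⁻ reach?))
                                         (∈⇒χ (∈⟦⟧⁺ rest? (x∈D , ¬r))))
                              (sym (∈⇒χ x∈D))

    -- Every partition of the vertex set has at least the density ∣ D ∣ / p of the partition into
    -- singletons; written without subtraction.
    Dense : Set
    Dense = ∀ {c} (lab : Fin (suc p) → Fin c) → (∀ i → ∃[ v ] lab v ≡ i) → (R : Subset n) →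
            (∀ {e} → e ∈ D → lab (a e) ≢ lab (b e) → e ∈ R) → ∣ D ∣ * c ≤ ∣ R ∣ * p + ∣ D ∣

    -- No edge of `D` crosses the partition into components, so density with empty `R` allows just
    -- one component, and the spanning forest is a tree.
    spanning-tree : Dense → 0 < ∣ D ∣ → ∃ (IsTree a b D)
    spanning-tree dense 0<m = forest , record
      { F⊆D = forest⊆F ; connected = λ u v → join (unique (label u) (label v))
      ; tree-size = suc-injective (trans (+-comm 1 _)
          (trans (cong (∣ forest ∣ +_) (sym count≡1)) forest-size)) }
      where
      open Components (components a b D)
      m = ∣ D ∣
      count≤1 : count ≤ 1
      count≤1 = *-cancelˡ-≤ m {{>-nonZero 0<m}} (begin
        m * count           ≤⟨ dense label onto ∅ (λ e∈D e≢ → contradiction (closed e∈D) e≢) ⟩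
        ∣ ∅ {n} ∣ * p + m   ≡⟨ cong (λ c → c * p + m) (∣⊥∣≡0 n) ⟩
        m                   ≡⟨ *-identityʳ m ⟨
        m * 1               ∎)
        where open ≤-Reasoning
      count≡1 : count ≡ 1
      count≡1 = ≤-antisym count≤1 (>-nonZero⁻¹ count {{nonZeroIndex (label zero)}})
      unique : ∀ (x y : Fin count) → x ≡ y
      unique with count | count≡1
      ... | _ | refl = λ { zero zero → refl }

    -- Counting edges on the two sides of a cut.

    module _ {N} {T : Fin N → Subset n} (trees : ∀ i → IsTree a b D (T i)) {s} (C : Cut T s) where
      open Cut C

      -- Double counting of the incidences between trees and edges of `X`.
      total-load : ∀ X → sum (λ x → χ X x * edgeLoad T x) ≡ sum (λ i → ∣ T i ∩ X ∣)
      total-load X = begin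
        sum (λ x → χ X x * edgeLoad T x)
          ≡⟨ sum-cong-≗ (λ x → *-distribˡ-sum (χ X x) (λ i → χ (T i) x)) ⟩
        sum (λ x → sum (λ i → χ X x * χ (T i) x))       ≡⟨ ∑-comm (λ x i → χ X x * χ (T i) x) ⟩
        sum (λ i → sum (λ x → χ X x * χ (T i) x))       ≡⟨ sum-cong-≗ (λ i → ∣∩∣ (T i) X) ⟨
        sum (λ i → ∣ T i ∩ X ∣)                         ∎
        where open ≡-Reasoning

      tree-split : ∀ i → ∣ T i ∩ R ∣ + ∣ T i ∩ K ∣ ≡ p
      tree-split i = begin
        ∣ T i ∩ R ∣ + ∣ T i ∩ K ∣                        ≡⟨ cong₂ _+_ (∣∩∣ (T i) R) (∣∩∣ (T i) K) ⟩
        sum (λ x → χ R x * χ (T i) x) + sum (λ x → χ K x * χ (T i) x)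
          ≡⟨ ∑-distrib-+ (λ x → χ R x * χ (T i) x) (λ x → χ K x * χ (T i) x) ⟨
        sum (λ x → χ R x * χ (T i) x + χ K x * χ (T i) x) ≡⟨ sum-cong-≗ split ⟩
        sum (χ (T i))                                   ≡⟨ ∣p∣≡sum (T i) ⟨
        ∣ T i ∣                                         ≡⟨ IsTree.tree-size (trees i) ⟩
        p                                               ∎
        where
        open ≡-Reasoning
        split : ∀ x → χ R x * χ (T i) x + χ K x * χ (T i) x ≡ χ (T i) x
        split x = trans (sym (*-distribʳ-+ (χ (T i) x) (χ R x) (χ K x)))
                        (trans (cong (_* χ (T i) x) (cover x)) absorb)
          where
          absorb : χ D x * χ (T i) x ≡ χ (T i) x
          absorb with x ∈? T i
          ... | yes x∈T rewrite ∈⇒χ x∈T | ∈⇒χ (IsTree.F⊆D (trees i) x∈T) = refl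
          ... | no x∉T  rewrite ∉⇒χ x∉T = *-zeroʳ (χ D x)

      record Counts : Set where
        -- K has q + 1 components.
        field
          q           : ℕ
          dense       : ∣ D ∣ * q ≤ ∣ R ∣ * p
          heavy-total : s * ∣ R ∣ ≤ N * q
          light-total : N * p ≤ N * q + s * ∣ K ∣
          whole       : ∣ R ∣ + ∣ K ∣ ≡ ∣ D ∣

      -- Density is applied to the components of `K`, which only edges of `R` can cross. Spanning
      -- these components costs each tree at least `p - q` edges of `K`, which leaves at most `q`
      -- for `R`; summing over the trees bounds the total loads on both sides.
      counts : Dense → Counts
      counts dense = record
        { q = q
        ; dense = +-cancelʳ-≤ (∣ D ∣) _ _ (begin
            ∣ D ∣ * q + ∣ D ∣      ≡⟨ +-comm _ ∣ D ∣ ⟩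
            ∣ D ∣ + ∣ D ∣ * q      ≡⟨ *-suc ∣ D ∣ q ⟨
            ∣ D ∣ * suc q          ≡⟨ cong (∣ D ∣ *_) 1+q≡count ⟩
            ∣ D ∣ * count          ≤⟨ dense label onto R crossing ⟩
            ∣ R ∣ * p + ∣ D ∣      ∎)
        ; heavy-total = begin
            s * ∣ R ∣                        ≡⟨ cong (s *_) (∣p∣≡sum R) ⟩
            s * sum (χ R)                    ≡⟨ *-distribˡ-sum s (χ R) ⟩
            sum (λ x → s * χ R x)            ≤⟨ sum-mono heavy-term ⟩
            sum (λ x → χ R x * edgeLoad T x) ≡⟨ total-load R ⟩
            sum (λ i → ∣ T i ∩ R ∣)          ≤⟨ sum-mono (λ i → few-R i) ⟩
            sum {N} (λ i → q)                ≡⟨ sum-const N q ⟩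
            N * q                            ∎
        ; light-total = begin
            N * p                                   ≡⟨ sum-const N p ⟨
            sum {N} (λ i → p)                       ≤⟨ sum-mono (λ i → many-K i) ⟩
            sum (λ i → q + ∣ T i ∩ K ∣)             ≡⟨ ∑-distrib-+ (λ _ → q) (λ i → ∣ T i ∩ K ∣) ⟩
            sum {N} (λ i → q) + sum (λ i → ∣ T i ∩ K ∣) ≡⟨ cong₂ _+_ (sum-const N q) (sym (total-load K)) ⟩
            N * q + sum (λ x → χ K x * edgeLoad T x) ≤⟨ +-monoʳ-≤ (N * q) (sum-mono light-term) ⟩
            N * q + sum (λ x → s * χ K x)           ≡⟨ cong (N * q +_) (*-distribˡ-sum s (χ K)) ⟨
            N * q + s * sum (χ K)                   ≡⟨ cong (λ z → N * q + s * z) (∣p∣≡sum K) ⟨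
            N * q + s * ∣ K ∣                       ∎
        ; whole = begin-equality
            ∣ R ∣ + ∣ K ∣               ≡⟨ cong₂ _+_ (∣p∣≡sum R) (∣p∣≡sum K) ⟩
            sum (χ R) + sum (χ K)       ≡⟨ ∑-distrib-+ (χ R) (χ K) ⟨
            sum (λ x → χ R x + χ K x)   ≡⟨ sum-cong-≗ cover ⟩
            sum (χ D)                   ≡⟨ ∣p∣≡sum D ⟨
            ∣ D ∣                       ∎ }
        where
        open ≤-Reasoning
        open Components (components a b K)
        q : ℕ
        q = pred count
        1+q≡count : suc q ≡ count
        1+q≡count = suc-pred count {{nonZeroIndex (label zero)}}
        crossing : ∀ {e} → e ∈ D → label (a e) ≢ label (b e) → e ∈ R
        crossing {e} e∈D e≢ with e ∈? R
        ... | yes e∈R = e∈R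
        ... | no e∉R with e ∈? K
        ...   | yes e∈K = contradiction (closed e∈K) e≢
        ...   | no e∉K with () ← trans (sym (cong₂ _+_ (∉⇒χ e∉R) (∉⇒χ e∉K))) (trans (cover e) (∈⇒χ e∈D))
        many-K : ∀ i → p ≤ q + ∣ T i ∩ K ∣
        many-K i = s≤s⁻¹ (begin
          suc p
            ≤⟨ connecting-size label onto (λ eq → bind (K-spanned i) (weaken forest⊆F (join eq))) ⟩
          ∣ T i ∩ K ∣ + count     ≡⟨ +-comm _ count ⟩
          count + ∣ T i ∩ K ∣     ≡⟨ cong (_+ ∣ T i ∩ K ∣) 1+q≡count ⟨
          suc (q + ∣ T i ∩ K ∣)   ∎)
        few-R : ∀ i → ∣ T i ∩ R ∣ ≤ q
        few-R i = +-cancelʳ-≤ (∣ T i ∩ K ∣) _ _ (≤-trans (≤-reflexive (tree-split i)) (many-K i))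
        heavy-term : ∀ x → s * χ R x ≤ χ R x * edgeLoad T x
        heavy-term x with x ∈? R
        ... | yes x∈R rewrite ∈⇒χ x∈R | *-identityʳ s | +-identityʳ (edgeLoad T x) = heavy x∈R
        ... | no x∉R  rewrite ∉⇒χ x∉R | *-zeroʳ s = z≤n
        light-term : ∀ x → χ K x * edgeLoad T x ≤ s * χ K x
        light-term x with x ∈? K
        ... | yes x∈K rewrite ∈⇒χ x∈K | *-identityʳ s | +-identityʳ (edgeLoad T x) = light x∈K
        ... | no x∉K  rewrite ∉⇒χ x∉K = z≤n

      -- Combining `dense` with `heavy-total` gives the inequality multiplied by `q`. If `q` is
      -- zero, `heavy-total` and an edge in `R` force `s` to be zero.
      heavy-bound : Dense → ∀ {x} → x ∈ R → s * ∣ D ∣ ≤ N * p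
      heavy-bound dense′ x∈R with counts dense′
      ... | record { q = zero ; heavy-total = heavy-total } = ≤-trans (≤-reflexive (cong (_* ∣ D ∣) s≡0)) z≤n
        where
        s≡0 : s ≡ 0
        s≡0 = n≤0⇒n≡0 (*-cancelʳ-≤ s 0 (∣ R ∣) {{>-nonZero (∈⇒0<∣∣ x∈R)}}
          (≤-trans heavy-total (≤-reflexive (*-zeroʳ N))))
      ... | record { q = q@(suc _) ; dense = dense ; heavy-total = heavy-total } =
        *-cancelʳ-≤ (s * ∣ D ∣) (N * p) q (begin
          s * ∣ D ∣ * q      ≡⟨ *-assoc s _ _ ⟩
          s * (∣ D ∣ * q)    ≤⟨ *-monoʳ-≤ s dense ⟩
          s * (∣ R ∣ * p)    ≡⟨ *-assoc s _ _ ⟨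
          s * ∣ R ∣ * p      ≤⟨ *-monoˡ-≤ p heavy-total ⟩
          N * q * p          ≡⟨ swap N q p ⟩
          N * p * q          ∎)
        where
        open ≤-Reasoning
        swap : ∀ x y z → x * y * z ≡ x * z * y
        swap = solve-∀

      -- Density, restated for `K`, gives `q < p` because `K` is nonempty; were the claim false,
      -- `main` would give `p ≤ q`.
      light-bound : Dense → 0 < p → ∀ {x} → x ∈ K → N * p ≤ s * ∣ D ∣
      light-bound dense′ 0<p x∈K = ≮⇒≥ λ lt → <⇒≱ (K-counts) (p≤q lt)
        where
        open ≤-Reasoning
        open Counts (counts dense′)
        m = ∣ D ∣
        K+Dq≤Dp : ∣ K ∣ * p + m * q ≤ m * p
        K+Dq≤Dp = begin
          ∣ K ∣ * p + m * q       ≤⟨ +-monoʳ-≤ (∣ K ∣ * p) dense ⟩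
          ∣ K ∣ * p + ∣ R ∣ * p    ≡⟨ *-distribʳ-+ p ∣ K ∣ ∣ R ∣ ⟨
          (∣ K ∣ + ∣ R ∣) * p      ≡⟨ cong (_* p) (trans (+-comm ∣ K ∣ _) whole) ⟩
          m * p                   ∎
        K-counts : q < p
        K-counts = *-cancelˡ-< m q p (begin-strict
          m * q                  <⟨ +-monoˡ-< (m * q) (*-mono-≤ (∈⇒0<∣∣ x∈K) 0<p) ⟩
          ∣ K ∣ * p + m * q       ≤⟨ K+Dq≤Dp ⟩
          m * p                  ∎)
        -- This is `(N p - s m) (p - q) ≤ 0` without subtraction.
        main : N * p * p + s * m * q ≤ N * p * q + s * m * p
        main = begin
          N * p * p + s * m * q                   ≤⟨ +-monoˡ-≤ (s * m * q) (*-monoˡ-≤ p light-total) ⟩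
          (N * q + s * ∣ K ∣) * p + s * m * q      ≡⟨ regroup N p q s ∣ K ∣ m ⟩
          N * p * q + s * (∣ K ∣ * p + m * q)      ≤⟨ +-monoʳ-≤ (N * p * q) (*-monoʳ-≤ s K+Dq≤Dp) ⟩
          N * p * q + s * (m * p)                 ≡⟨ cong (N * p * q +_) (*-assoc s m p) ⟨
          N * p * q + s * m * p                   ∎
          where
          regroup : ∀ N p q s k m → (N * q + s * k) * p + s * m * q ≡ N * p * q + s * (k * p + m * q)
          regroup = solve-∀
        p≤q : s * m < N * p → p ≤ q
        p≤q lt with m≤n⇒∃[o]m+o≡n lt
        -- Here `suc o` is the positive difference `N p - s m`; after cancelling the common terms,
        -- `main` compares its multiples by `p` and `q`.
        ... | o , eq = *-cancelˡ-≤ (suc o) (+-cancelˡ-≤ (s * m * p + s * m * q) _ _ (begin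
          s * m * p + s * m * q + suc o * p   ≡⟨ collect (s * m) o p q ⟩
          (suc (s * m) + o) * p + s * m * q   ≡⟨ cong (λ z → z * p + s * m * q) eq ⟩
          N * p * p + s * m * q               ≤⟨ main ⟩
          N * p * q + s * m * p               ≡⟨ cong (λ z → z * q + s * m * p) eq ⟨
          (suc (s * m) + o) * q + s * m * p   ≡⟨ collect (s * m) o q p ⟨
          s * m * q + s * m * p + suc o * q   ≡⟨ cong (_+ suc o * q) (+-comm (s * m * q) _) ⟩
          s * m * p + s * m * q + suc o * q   ∎))
          where
          collect : ∀ B o p q → B * p + B * q + suc o * p ≡ (suc B + o) * p + B * q
          collect = solve-∀

    -- Balanced packings: loads within 1 of `N p / m`, with the denominator cleared.

    Balanced : ∀ {N} → (Fin N → Subset n) → Set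
    Balanced {N} T = ∀ e → e ∈ D →
      edgeLoad T e * ∣ D ∣ ≤ N * p + ∣ D ∣ × N * p ≤ edgeLoad T e * ∣ D ∣ + ∣ D ∣

    -- The threshold one below the load of `e` puts `e` into `R`, and the threshold one above puts
    -- it into `K`. These shifts by one are the deviation allowed; for load zero the upper bound is
    -- trivial.
    optimal-balanced : Dense → 0 < p → ∀ {N} ((T , trees) : Packing N) →
                       (∀ (T′ : Packing N) → energy T ≤ energy (proj₁ T′)) → Balanced T
    optimal-balanced dense 0<p {N} (T , trees) optimal e e∈D = upper (edgeLoad T e) refl , lower
      where
      open ≤-Reasoning
      m = ∣ D ∣
      upper : ∀ l → edgeLoad T e ≡ l → l * m ≤ N * p + m
      upper zero    _  = z≤n
      upper (suc s) eq = decidable-stable (_ ≤? _) λ fails → cut (T , trees) optimal s λ C → fails (begin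
        m + s * m     ≡⟨ +-comm m _ ⟩
        s * m + m     ≤⟨ +-monoˡ-≤ m (heavy-bound trees C dense (Cut.heavier∈R C e∈D (≤-reflexive (sym eq)))) ⟩
        N * p + m     ∎)
      lower : N * p ≤ edgeLoad T e * m + m
      lower = decidable-stable (_ ≤? _) λ fails → cut (T , trees) optimal (suc (edgeLoad T e)) λ C → fails (begin
        N * p               ≤⟨ light-bound trees C dense 0<p (Cut.lighter∈K C e∈D ≤-refl) ⟩
        m + edgeLoad T e * m    ≡⟨ +-comm m _ ⟩
        edgeLoad T e * m + m    ∎)

    anyPacking? : ∀ N {P : Vec (Subset n) N → Set} → (∀ v → Dec (P v)) → Dec (∃ P)
    anyPacking? zero    P? = map′ (λ p → [] , p) (λ { ([] , p) → p }) (P? [])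
    anyPacking? (suc N) P? = map′ (λ (F , v , p) → F ∷ v , p) (λ { (F ∷ v , p) → F , v , p })
      (anySubset? λ F → anyPacking? N (P? ∘ (F ∷_)))

    -- The minimiser of the energy exists only under double negation, but being a balanced packing
    -- is decidable and there are finitely many vectors of edge sets. The search therefore cannot
    -- fail.
    balanced-packing : Dense → 0 < p → 0 < ∣ D ∣ → ∀ N → Σ[ (T , _) ∈ Packing N ] Balanced T
    balanced-packing dense 0<p 0<m N =
      let v , trees , balanced = decidable-stable search λ none →
            -- The descent starts from `N` copies of a single spanning tree.
            least (energy ∘ proj₁) ((λ _ → proj₁ tree) , λ _ → proj₂ tree) λ ((T , trees) , optimal) →
              none (tabulate T , respects (λ i → sym (lookup∘tabulate T i)) trees
                (optimal-balanced dense 0<p (T , trees) optimal))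
      in (lookup v , trees) , balanced
      where
      tree : ∃ (IsTree a b D)
      tree = spanning-tree dense 0<m
      Good : (Fin N → Subset n) → Set
      Good T = (∀ i → IsTree a b D (T i)) × Balanced T
      respects : ∀ {T T′ : Fin N → Subset n} → (∀ i → T i ≡ T′ i) →
                 (∀ i → IsTree a b D (T i)) → Balanced T → Good T′
      respects {T} {T′} T≗T′ trees balanced = (λ i → subst (IsTree a b D) (T≗T′ i) (trees i)) ,
        λ e e∈D → subst (λ l → l * ∣ D ∣ ≤ N * p + ∣ D ∣ × N * p ≤ l * ∣ D ∣ + ∣ D ∣)
          (sum-cong-≗ λ i → cong (λ F → χ F e) (T≗T′ i)) (balanced e e∈D)
      search : Dec (∃[ v ] Good (lookup v))
      search = anyPacking? N λ v → all? (λ i → isTree? a b D (lookup v i)) ×-dec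
        all? (λ e → e ∈? D →-dec (_ ≤? _) ×-dec (_ ≤? _))

-- Partitions and induced subgraphs of the multigraph.

module _ where
  open import Data.Bool.Base using (true; false; if_then_else_; _∧_; not)
  open import Data.Empty using (⊥)
  open import Data.Fin.Base using (Fin; zero; suc)
  open import Data.Fin.Properties using (_≟_)
  open import Data.Fin.Subset using (Subset; _∈_; _∉_; _⊆_; ∣_∣; ⊤) renaming (⊥ to ∅)
  open import Data.Fin.Subset.Properties
    using (p⊆q⇒∣p∣≤∣q∣; _∈?_; nonempty?; x∉p⇒x∈∁p; ∣⊥∣≡0; ∣⊤∣≡n; ∉⊥; ∈⊤)
  open import Data.Integer.Base as ℤ using (+_)
  open import Data.List.Relation.Unary.All as All using (All; []; _∷_)
  open import Data.List.Relation.Unary.AllPairs.Core using (_∷_)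
  open import Data.Nat.Base
  open import Data.Nat.Properties hiding (_≟_)
  open import Data.Nat.Tactic.RingSolver using (solve-∀)
  open import Data.Product.Base hiding (swap)
  import Data.Rational.Base as ℚ
  open ℚ using (ℚ; mkℚ; 0ℚ; 1ℚ)
  import Data.Rational.Properties as ℚ
  open import Data.Sum.Base using (_⊎_; inj₁; inj₂; [_,_]′)
  open import Data.Vec.Base using ([]; _∷_; lookup; tabulate)
  open import Data.Vec.Properties using ([]=⇒lookup; lookup⇒[]=; lookup∘tabulate)
  open import Defs hiding (#V; #E; end₁; end₂; no-loop; V; E; tree)
  open import Function.Base using (id; _∘_)
  open import Relation.Binary.PropositionalEquality
  open import Relation.Nullary
  open import Relation.Nullary.Decidable
    using (dec-true; dec-false; decidable-stable; _×-dec_; _⊎-dec_; ¬?)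
  open import Algebra.Properties.CommutativeMonoid.Sum +-0-commutativeMonoid
    using (sum; sum-cong-≗; ∑-distrib-+; ∑-comm)

  ∧-true : ∀ {x y} → x ∧ y ≡ true → x ≡ true × y ≡ true
  ∧-true {true} {true} refl = refl , refl

  does-true : ∀ {A : Set} (A? : Dec A) → does A? ≡ true → A
  does-true (yes a) refl = a

  χ-cong : ∀ {m} {X Y : Subset m} {x} → (x ∈ X → x ∈ Y) → (x ∈ Y → x ∈ X) → χ X x ≡ χ Y x
  χ-cong {X = X} {Y} {x} X⇒Y Y⇒X with x ∈? X
  ... | yes x∈X = trans (∈⇒χ x∈X) (sym (∈⇒χ (X⇒Y x∈X)))
  ... | no x∉X  = trans (∉⇒χ x∉X) (sym (∉⇒χ (x∉X ∘ Y⇒X)))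

  ∣S∣≡1⇒≡ : ∀ {m} {S : Subset m} {u v} → ∣ S ∣ ≡ 1 → u ∈ S → v ∈ S → u ≡ v
  ∣S∣≡1⇒≡ {S = S} {u} {v} ∣S∣≡1 u∈S v∈S = decidable-stable (u ≟ v) λ u≢v →
    <⇒≱ (∈⇒0<∣∣ (∈-remove⁺ {F = S} {v} u∈S u≢v))
        (≤-reflexive (suc-injective (trans (∣remove∣ v∈S) ∣S∣≡1)))

  module _ (G : Multigraph) where
    open Multigraph G using (#V; #E; end₁; end₂; no-loop)

    within? : ∀ (S : Subset #V) e → Dec (end₁ e ∈ S × end₂ e ∈ S)
    within? S e = (end₁ e ∈? S) ×-dec (end₂ e ∈? S)

    within : Subset #V → Subset #E
    within S = ⟦ within? S ⟧

    ConnectedOn : Subset #V → Set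
    ConnectedOn S = ∀ {u v} → u ∈ S → v ∈ S → Path end₁ end₂ (within S) u v

    module _ {S : Subset #V} {c} (P : Partition G S c) where
      open Partition P

      ∈-class⁺ : ∀ {v} → v ∈ S → v ∈ class (label v)
      ∈-class⁺ {v} v∈S = lookup⇒[]= v _ (trans (lookup∘tabulate _ v)
        (cong₂ _∧_ ([]=⇒lookup v∈S) (dec-true (label v ≟ label v) refl)))

      ∈-class⁻ : ∀ {i v} → v ∈ class i → v ∈ S × label v ≡ i
      ∈-class⁻ {i} {v} v∈ with ∧-true {lookup S v} (trans (sym (lookup∘tabulate _ v)) ([]=⇒lookup v∈))
      ... | v∈S , eq = lookup⇒[]= v S v∈S , does-true (label v ≟ i) eq

      ∈-crossing⁺ : ∀ {e} → e ∈ within S → label (end₁ e) ≢ label (end₂ e) → e ∈ crossing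
      ∈-crossing⁺ {e} e∈ e≢ =
        let e₁∈S , e₂∈S = ∈⟦⟧⁻ (within? S) e∈ in lookup⇒[]= e _ (trans (lookup∘tabulate _ e)
          (cong₂ _∧_ (cong₂ _∧_ ([]=⇒lookup e₁∈S) ([]=⇒lookup e₂∈S))
            (cong not (dec-false (label (end₁ e) ≟ label (end₂ e)) e≢))))

      ∈-crossing⁻ : ∀ {e} → e ∈ crossing → e ∈ within S × label (end₁ e) ≢ label (end₂ e)
      ∈-crossing⁻ {e} e∈ with ∧-true {lookup S (end₁ e) ∧ lookup S (end₂ e)}
                                     (trans (sym (lookup∘tabulate _ e)) ([]=⇒lookup e∈))
      ... | in-S , eq with ∧-true {lookup S (end₁ e)} in-S | label (end₁ e) ≟ label (end₂ e)
      ...   | e₁∈S , e₂∈S | no e≢ = ∈⟦⟧⁺ (within? S) (lookup⇒[]= _ S e₁∈S , lookup⇒[]= _ S e₂∈S) , e≢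

      class-⊆ : ∀ {i e} → e ∈ within (class i) → e ∈ within S
      class-⊆ e∈ = let e₁∈ , e₂∈ = ∈⟦⟧⁻ (within? (class _)) e∈ in
        ∈⟦⟧⁺ (within? S) (proj₁ (∈-class⁻ e₁∈) , proj₁ (∈-class⁻ e₂∈))

      class-label : ∀ {i e} → e ∈ within (class i) → label (end₁ e) ≡ i × label (end₂ e) ≡ i
      class-label e∈ = let e₁∈ , e₂∈ = ∈⟦⟧⁻ (within? (class _)) e∈ in
        proj₂ (∈-class⁻ e₁∈) , proj₂ (∈-class⁻ e₂∈)

      same-label : ∀ {e} → e ∈ within S → label (end₁ e) ≡ label (end₂ e) → e ∈ within (class (label (end₁ e)))
      same-label {e} e∈ eq = let e₁∈ , e₂∈ = ∈⟦⟧⁻ (within? S) e∈ in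
        ∈⟦⟧⁺ (within? (class (label (end₁ e))))
          (∈-class⁺ e₁∈ , subst (λ i → end₂ e ∈ class i) (sym eq) (∈-class⁺ e₂∈))

      χ-class : ∀ i v → χ (class i) v ≡ δ (label v) i * χ S v
      χ-class i v rewrite lookup∘tabulate (λ v → lookup S v ∧ does (label v ≟ i)) v
        with lookup S v | does (label v ≟ i)
      ... | true  | true  = refl
      ... | true  | false = refl
      ... | false | true  = refl
      ... | false | false = refl

      sum-∣class∣ : sum (λ i → ∣ class i ∣) ≡ ∣ S ∣
      sum-∣class∣ = begin
        sum (λ i → ∣ class i ∣)                             ≡⟨ sum-cong-≗ (λ i → ∣p∣≡sum (class i)) ⟩
        sum (λ i → sum (λ v → χ (class i) v))               ≡⟨ ∑-comm (λ i v → χ (class i) v) ⟩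
        sum (λ v → sum (λ i → χ (class i) v))
          ≡⟨ sum-cong-≗ (λ v → sum-cong-≗ (λ i → χ-class i v)) ⟩
        sum (λ v → sum (λ i → δ (label v) i * χ S v))
          ≡⟨ sum-cong-≗ (λ v → sum-δ (label v) (λ _ → χ S v)) ⟩
        sum (χ S)                                           ≡⟨ ∣p∣≡sum S ⟨
        ∣ S ∣                                               ∎
        where open ≡-Reasoning

    -- partVal P ≤ partVal Q for all Q, with the denominators cleared.
    MinimalCrossing : ∀ {S j} → Partition G S (2 + j) → Set
    MinimalCrossing {S} {j} P = ∀ {j′} (Q : Partition G S (2 + j′)) →
      ∣ Partition.crossing P ∣ * suc j′ ≤ ∣ Partition.crossing Q ∣ * suc j

    minimal-crossing : ∀ {S j} (P : Partition G S (2 + j)) → IsMinimal G P → MinimalCrossing P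
    minimal-crossing {j = j} P minimal {j′} Q =
      /-cancel-≤ (∣ Partition.crossing P ∣) j (∣ Partition.crossing Q ∣) j′ (minimal Q)

    module _ {S : Subset #V} {j} (P : Partition G S (2 + j)) (minimal : MinimalCrossing P) where
      open Partition P
      private
        m : ℕ
        m = ∣ crossing ∣

      -- A partition of the quotient pulls back along `label` to a coarser partition of `S`, to
      -- which minimality applies. A single class has no partition value, but there the bound is
      -- immediate.
      dense : Dense (label ∘ end₁) (label ∘ end₂) crossing
      dense {zero}  lab _ with () ← lab zero
      dense {suc zero} lab _ R _ = ≤-trans (≤-reflexive (*-identityʳ m)) (m≤n+m m _)
      dense {suc (suc j′)} lab onto′ R crossing⊆R = begin
        m * (2 + j′)               ≡⟨ *-suc m (suc j′) ⟩
        m + m * suc j′             ≤⟨ +-monoʳ-≤ m (minimal Q) ⟩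
        m + ∣ Partition.crossing Q ∣ * suc j ≤⟨ +-monoʳ-≤ m (*-monoˡ-≤ (suc j) (p⊆q⇒∣p∣≤∣q∣ Q⊆R)) ⟩
        m + ∣ R ∣ * suc j           ≡⟨ +-comm m _ ⟩
        ∣ R ∣ * suc j + m           ∎
        where
        open ≤-Reasoning
        Q : Partition G S (2 + j′)
        Q = record { label = lab ∘ label ; onto = λ i →
          let x , x↦i = onto′ i ; v , v∈S , v↦x = onto x in v , v∈S , trans (cong lab v↦x) x↦i }
        Q⊆R : Partition.crossing Q ⊆ R
        Q⊆R e∈ = let e∈S , e≢ = ∈-crossing⁻ Q e∈ in crossing⊆R (∈-crossing⁺ P e∈S (e≢ ∘ cong lab)) e≢

      -- Without crossing edges `label` would be constant along paths in `S`, although it takes two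
      -- values.
      0<crossing : ConnectedOn S → 0 < m
      0<crossing connected with onto zero | onto (suc zero)
      ... | u , u∈S , u↦0 | v , v∈S , v↦1 with nonempty? crossing
      ...   | yes (e , e∈) = ∈⇒0<∣∣ e∈
      ...   | no none with () ← trans (sym u↦0) (trans (path-invariant label
                (λ {e} e∈S → decidable-stable (_ ≟ _) λ e≢ → none (e , ∈-crossing⁺ P e∈S e≢))
                (connected u∈S v∈S)) v↦1)

      -- Splitting a class in two without creating crossing edges would lower the partition value.
      class-inseparable : 0 < m → ∀ i {Away : Fin #V → Set} → (∀ w → Dec (Away w)) →
                          (∀ {w} → Away w → w ∈ class i) → ∃ Away → ∃[ u ] (u ∈ class i × ¬ Away u) →
                          ¬ (∀ {e} → e ∈ within (class i) →
                             (Away (end₁ e) → Away (end₂ e)) × (Away (end₂ e) → Away (end₁ e)))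
      class-inseparable 0<m i {Away} away? away⊆ (v , v-away) (u , u∈ , u-rest) closed =
        -- The refinement has one more class and no more crossing edges, so minimality would give
        -- `m * (2 + j) ≤ m * (1 + j)`.
        <⇒≱ (*-monoʳ-< m {{>-nonZero 0<m}} (n<1+n (suc j)))
            (≤-trans (minimal Q) (*-monoˡ-≤ (suc j) (p⊆q⇒∣p∣≤∣q∣ Q⊆P)))
        where
        refined : Fin #V → Fin (3 + j)
        refined w = if does (away? w) then zero else suc (label w)
        refined-away : ∀ {w} → Away w → refined w ≡ zero
        refined-away {w} away rewrite dec-true (away? w) away = refl
        refined-rest : ∀ {w} → ¬ Away w → refined w ≡ suc (label w)
        refined-rest {w} rest rewrite dec-false (away? w) rest = refl
        Q : Partition G S (3 + j)
        Q = record { label = refined ; onto = onto′ }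
          where
          onto′ : ∀ c → ∃[ w ] w ∈ S × refined w ≡ c
          onto′ zero = v , proj₁ (∈-class⁻ P (away⊆ v-away)) , refined-away v-away
          onto′ (suc c) with c ≟ i
          ... | yes refl = u , proj₁ (∈-class⁻ P u∈) ,
            trans (refined-rest u-rest) (cong suc (proj₂ (∈-class⁻ P u∈)))
          ... | no c≢i = let w , w∈S , w↦c = onto c in w , w∈S ,
            trans (refined-rest λ w-away → c≢i (trans (sym w↦c) (proj₂ (∈-class⁻ P (away⊆ w-away)))))
                  (cong suc w↦c)
        Q⊆P : Partition.crossing Q ⊆ crossing
        Q⊆P {e} e∈ with ∈-crossing⁻ Q e∈
        ... | e∈S , e≢ = ∈-crossing⁺ P e∈S λ same → e≢ (agree same (away? (end₁ e)) (away? (end₂ e)))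
          where
          agree : label (end₁ e) ≡ label (end₂ e) → Dec (Away (end₁ e)) → Dec (Away (end₂ e)) →
                  refined (end₁ e) ≡ refined (end₂ e)
          agree same (yes away₁) (yes away₂) = trans (refined-away away₁) (sym (refined-away away₂))
          agree same (no rest₁)  (no rest₂)  =
            trans (refined-rest rest₁) (trans (cong suc same) (sym (refined-rest rest₂)))
          agree same (yes away₁) (no rest₂)  = contradiction (proj₁ (closed e∈i) away₁) rest₂
            where
            e∈i : e ∈ within (class i)
            e∈i = subst (λ c → e ∈ within (class c)) (proj₂ (∈-class⁻ P (away⊆ away₁)))
                    (same-label P e∈S same)
          agree same (no rest₁)  (yes away₂) = contradiction (proj₂ (closed e∈i) away₂) rest₁
            where
            e∈i : e ∈ within (class i)
            e∈i = subst (λ c → e ∈ within (class c)) (trans same (proj₂ (∈-class⁻ P (away⊆ away₂))))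
                    (same-label P e∈S same)

      -- Otherwise the vertices of the class that `u` does not reach could be split off. This passes
      -- connectivity on to the recursive calls.
      class-connected : 0 < m → ∀ i → ConnectedOn (class i)
      class-connected 0<m i {u} {v} u∈ v∈ = decidable-stable (reaches? v) λ ¬u⇝v →
        class-inseparable 0<m i (λ w → (w ∈? class i) ×-dec ¬? (reaches? w)) proj₁
          (v , v∈ , ¬u⇝v) (u , u∈ , λ (_ , ¬u⇝u) → ¬u⇝u stop)
          λ e∈i → let e₁∈ , e₂∈ = ∈⟦⟧⁻ (within? (class i)) e∈i in
            (λ (_ , ¬u⇝e₁) → e₂∈ , λ u⇝e₂ → ¬u⇝e₁ (u⇝e₂ ++ reverse (edge e∈i))) ,
            (λ (_ , ¬u⇝e₂) → e₁∈ , λ u⇝e₁ → ¬u⇝e₂ (u⇝e₁ ++ edge e∈i))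
        where
        reaches? : ∀ w → Dec (Path end₁ end₂ (within (class i)) u w)
        reaches? w = path? end₁ end₂ (within (class i)) u w

    -- Gluing packings of the classes along a packing of the quotient.

    module _ (N : ℕ) (Good : Fin #E → ℕ → Set) where

      -- `small` is one half of the edge count of a spanning tree; the other half follows from
      -- connectivity. `Good` constrains an edge only through its load, which is what gluing
      -- preserves.
      record GoodPacking (S : Subset #V) : Set where
        field
          tree    : Fin N → Subset #E
          tree⊆S  : ∀ t → tree t ⊆ within S
          spans   : ∀ t {u v} → u ∈ S → v ∈ S → Path end₁ end₂ (tree t) u v
          small   : ∀ t → suc ∣ tree t ∣ ≤ ∣ S ∣
          good    : ∀ {e} → e ∈ within S → Good e (edgeLoad tree e)

      module _ {S : Subset #V} {j} (P : Partition G S (2 + j)) (F : Fin N → Subset #E)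
               (F-tree : ∀ t → IsTree (Partition.label P ∘ end₁) (Partition.label P ∘ end₂)
                                      (Partition.crossing P) (F t))
               (F-good : ∀ {e} → e ∈ Partition.crossing P → Good e (edgeLoad F e))
               (sub : ∀ i → GoodPacking (Partition.class P i)) where
        open Partition P
        private
          module Sub i = GoodPacking (sub i)
          -- An edge inside a class is looked up in the class of its first end; a crossing edge lies
          -- in no class tree.
          glued? : ∀ t e → Dec (e ∈ F t ⊎ e ∈ Sub.tree (label (end₁ e)) t)
          glued? t e = (e ∈? F t) ⊎-dec (e ∈? Sub.tree (label (end₁ e)) t)
          glued : Fin N → Subset #E
          glued t = ⟦ glued? t ⟧
          F⊆glued : ∀ t → F t ⊆ glued t
          F⊆glued t e∈ = ∈⟦⟧⁺ (glued? t) (inj₁ e∈)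
          sub⊆glued : ∀ t i → Sub.tree i t ⊆ glued t
          sub⊆glued t i {e} e∈ = ∈⟦⟧⁺ (glued? t) (inj₂
            (subst (λ c → e ∈ Sub.tree c t) (sym (proj₁ (class-label P (Sub.tree⊆S i t e∈)))) e∈))
          within-class : ∀ t {u v} → u ∈ S → v ∈ S → label u ≡ label v → Path end₁ end₂ (glued t) u v
          within-class t {u} {v} u∈S v∈S eq = weaken (sub⊆glued t (label u))
            (Sub.spans (label u) t (∈-class⁺ P u∈S) (subst (λ c → v ∈ class c) (sym eq) (∈-class⁺ P v∈S)))
          -- Consecutive edges of a quotient path are joined inside the class between them by the
          -- tree of that class.
          lift : ∀ t {x y} → Path (label ∘ end₁) (label ∘ end₂) (F t) x y →
                 ∀ {u v} → u ∈ S → v ∈ S → label u ≡ x → label v ≡ y → Path end₁ end₂ (glued t) u v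
          lift t stop u∈S v∈S eq₁ eq₂ = within-class t u∈S v∈S (trans eq₁ (sym eq₂))
          lift t (fwd e e∈F p) u∈S v∈S eq₁ eq₂
            with ∈⟦⟧⁻ (within? S) (proj₁ (∈-crossing⁻ P (IsTree.F⊆D (F-tree t) e∈F)))
          ... | e₁∈ , e₂∈ = within-class t u∈S e₁∈ eq₁ ++ fwd e (F⊆glued t e∈F) (lift t p e₂∈ v∈S refl eq₂)
          lift t (bwd e e∈F p) u∈S v∈S eq₁ eq₂
            with ∈⟦⟧⁻ (within? S) (proj₁ (∈-crossing⁻ P (IsTree.F⊆D (F-tree t) e∈F)))
          ... | e₁∈ , e₂∈ = within-class t u∈S e₂∈ eq₁ ++ bwd e (F⊆glued t e∈F) (lift t p e₁∈ v∈S refl eq₂)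
          -- The `1 + j` edges of the quotient tree, plus the one extra unit on the left, give one
          -- unit to each of the `2 + j` classes.
          glued-size : ∀ t → suc ∣ glued t ∣ ≤ ∣ S ∣
          glued-size t = begin
            suc ∣ glued t ∣                                   ≡⟨ cong suc (∣p∣≡sum (glued t)) ⟩
            suc (sum (χ (glued t)))                           ≤⟨ s≤s (sum-mono pointwise) ⟩
            suc (sum (λ e → χ (F t) e + sum (λ i → χ (Sub.tree i t) e)))
              ≡⟨ cong suc (∑-distrib-+ (χ (F t)) (λ e → sum (λ i → χ (Sub.tree i t) e))) ⟩
            suc (sum (χ (F t)) + sum (λ e → sum (λ i → χ (Sub.tree i t) e)))
              ≡⟨ cong₂ (λ x y → suc (x + y)) F-size sub-size ⟩
            2 + j + sum (λ i → ∣ Sub.tree i t ∣)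
              ≡⟨ cong (_+ sum (λ i → ∣ Sub.tree i t ∣)) (trans (sum-const (2 + j) 1) (*-identityʳ (2 + j))) ⟨
            sum {2 + j} (λ _ → 1) + sum (λ i → ∣ Sub.tree i t ∣)
              ≡⟨ ∑-distrib-+ {2 + j} (λ _ → 1) (λ i → ∣ Sub.tree i t ∣) ⟨
            sum (λ i → suc ∣ Sub.tree i t ∣)                  ≤⟨ sum-mono (λ i → Sub.small i t) ⟩
            sum (λ i → ∣ class i ∣)                           ≡⟨ sum-∣class∣ P ⟩
            ∣ S ∣                                             ∎
            where
            open ≤-Reasoning
            F-size : sum (χ (F t)) ≡ suc j
            F-size = trans (sym (∣p∣≡sum (F t))) (IsTree.tree-size (F-tree t))
            sub-size : sum (λ e → sum (λ i → χ (Sub.tree i t) e)) ≡ sum (λ i → ∣ Sub.tree i t ∣)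
            sub-size = trans (∑-comm (λ e i → χ (Sub.tree i t) e))
              (sum-cong-≗ λ i → sym (∣p∣≡sum (Sub.tree i t)))
            pointwise : ∀ e → χ (glued t) e ≤ χ (F t) e + sum (λ i → χ (Sub.tree i t) e)
            pointwise e with e ∈? glued t
            ... | no e∉ rewrite ∉⇒χ e∉ = z≤n
            ... | yes e∈ rewrite ∈⇒χ e∈ with ∈⟦⟧⁻ (glued? t) e∈
            ...   | inj₁ e∈F = ≤-trans (≤-reflexive (sym (∈⇒χ e∈F))) (m≤m+n (χ (F t) e) _)
            ...   | inj₂ e∈i = ≤-trans (≤-reflexive (sym (∈⇒χ e∈i)))
                      (≤-trans (term≤sum (λ i → χ (Sub.tree i t) e) (label (end₁ e))) (m≤n+m _ (χ (F t) e)))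
          -- Each edge gets its load from one source: the packing of its class, or `F` if it
          -- crosses.
          glued-good : ∀ {e} → e ∈ within S → Good e (edgeLoad glued e)
          glued-good {e} e∈S with label (end₁ e) ≟ label (end₂ e)
          ... | yes same = subst (Good e)
            (sum-cong-≗ λ t → χ-cong {X = Sub.tree (label (end₁ e)) t} (sub⊆glued t _) λ e∈ →
              [ (λ e∈F → contradiction same (proj₂ (∈-crossing⁻ P (IsTree.F⊆D (F-tree t) e∈F)))) , id ]′
                (∈⟦⟧⁻ (glued? t) e∈))
            (Sub.good (label (end₁ e)) (same-label P e∈S same))
          ... | no differ = subst (Good e)
            (sum-cong-≗ λ t → χ-cong {X = F t} (F⊆glued t) λ e∈ →
              [ id , (λ e∈i → contradiction (sym (proj₂ (class-label P (Sub.tree⊆S _ t e∈i)))) differ) ]′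
                (∈⟦⟧⁻ (glued? t) e∈))
            (F-good (∈-crossing⁺ P e∈S differ))

        glue : GoodPacking S
        glue = record
          { tree   = glued
          ; tree⊆S = λ t e∈ → [ (λ e∈F → proj₁ (∈-crossing⁻ P (IsTree.F⊆D (F-tree t) e∈F)))
                              , (λ e∈i → class-⊆ P (Sub.tree⊆S _ t e∈i)) ]′ (∈⟦⟧⁻ (glued? t) e∈)
          ; spans  = λ t u∈S v∈S → lift t (IsTree.connected (F-tree t) _ _) u∈S v∈S refl refl
          ; small  = glued-size
          ; good   = glued-good }

      trivial-packing : ∀ {S} → ∣ S ∣ ≡ 1 → GoodPacking S
      trivial-packing {S} ∣S∣≡1 = record
        { tree = λ _ → ∅ ; tree⊆S = λ _ e∈ → contradiction e∈ ∉⊥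
        ; spans = λ _ u∈S v∈S → subst (Path end₁ end₂ ∅ _) (∣S∣≡1⇒≡ ∣S∣≡1 u∈S v∈S) stop
        ; small = λ _ → ≤-reflexive (trans (cong suc (∣⊥∣≡0 #E)) (sym ∣S∣≡1))
        -- An edge inside a single vertex would be a loop.
        ; good = λ {e} e∈S → let e₁∈ , e₂∈ = ∈⟦⟧⁻ (within? S) e∈S in
            contradiction (∣S∣≡1⇒≡ ∣S∣≡1 e₁∈ e₂∈) (no-loop e) }

    -- Packings close to the ideal loads.

    module _ (ℓ : Fin #E → ℚ) (N : ℕ) where

      Close : Fin #E → ℕ → Set
      Close e l = ℚ.∣ + l ℚ./ suc N ℚ.- ℓ e ∣ ℚ.≤ + 1 ℚ./ suc N

      balanced⇒close : ∀ {e l j} m → 0 < m → .{{nz : ℚ.NonZero (+ m ℚ./ suc j)}} →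
                       ℓ e ≡ ℚ.1/ (+ m ℚ./ suc j) →
                       l * m ≤ suc N * suc j + m × suc N * suc j ≤ l * m + m → Close e l
      balanced⇒close {e} {l} {j} (suc m) _ {{nz}} eq (upper , lower) =
        subst (λ x → ℚ.∣ + l ℚ./ suc N ℚ.- x ∣ ℚ.≤ + 1 ℚ./ suc N) (sym eq)
          (load-close l m j N {{nz}} upper lower)

      -- Recursion along the derivation of the ideal loads. All levels use `suc N` trees, so that
      -- trees of equal index can be glued.
      close-packing : ∀ {S} → ConnectedOn S → IdealOn G ℓ S → GoodPacking (suc N) Close S
      close-packing _ (single ∣S∣≡1) = trivial-packing (suc N) Close ∣S∣≡1
      close-packing connected (split {j} P minimal ideal ideals) = glue (suc N) Close P F F-tree
        (λ {e} e∈ → balanced⇒close {e} {edgeLoad F e} {j} (∣ Partition.crossing P ∣) 0<m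
                      {{partVal-nonZero G P e∈}} (ideal e e∈) (F-balanced e e∈))
        λ i → close-packing (class-connected P (minimal-crossing P minimal) 0<m i) (ideals i)
        where
        0<m = 0<crossing P (minimal-crossing P minimal) connected
        quotient = balanced-packing (Partition.label P ∘ end₁) (Partition.label P ∘ end₂)
                     (Partition.crossing P) (dense P (minimal-crossing P minimal)) (s≤s z≤n) 0<m (suc N)
        F = proj₁ (proj₁ quotient)
        F-tree = proj₂ (proj₁ quotient)
        F-balanced = proj₂ quotient

  -- From paths and edge counts to walks and spanning trees.

  module _ (G : Multigraph) where
    open Multigraph G using (#V; #E; end₁; end₂)

    walk⇒path : ∀ {F F′ u v} (w : Walk G F u v) → All (_∈ F′) (edges G w) → Path end₁ end₂ F′ u v
    walk⇒path stop _ = stop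
    walk⇒path (step e _ (inj₁ (refl , refl)) w) (e∈ ∷ es) = fwd e e∈ (walk⇒path w es)
    walk⇒path (step e _ (inj₂ (refl , refl)) w) (e∈ ∷ es) = bwd e e∈ (walk⇒path w es)

    path⇒walk : ∀ {F u v} → Path end₁ end₂ F u v → Walk G F u v
    path⇒walk stop        = stop
    path⇒walk (fwd e m p) = step e m (inj₁ (refl , refl)) (path⇒walk p)
    path⇒walk (bwd e m p) = step e m (inj₂ (refl , refl)) (path⇒walk p)

    edges∈ : ∀ {F u v} (w : Walk G F u v) → All (_∈ F) (edges G w)
    edges∈ stop           = []
    edges∈ (step _ m _ w) = m ∷ edges∈ w

    -- The first edge of a cycle could be removed, the rest of the cycle bypassing it. Then fewer
    -- than `#V - 1` edges would connect all vertices.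
    connected-small⇒tree : ∀ {F} → (∀ u v → Path end₁ end₂ F u v) → suc ∣ F ∣ ≤ #V → IsSpanningTree G F
    connected-small⇒tree {F} connected small = (λ u v → path⇒walk (connected u v)) , acyclic
      where
      bridge : ∀ {e} → e ∈ F → ¬ Path end₁ end₂ (remove F e) (end₁ e) (end₂ e)
      bridge {e} e∈F detour = <⇒≱ small (begin
        #V
          ≤⟨ connecting-size {F = remove F e} (λ _ → zero) (λ { zero → end₁ e , refl })
                                         (λ {u} {v} _ → bind reroute (connected u v)) ⟩
        (∣ remove F e ∣) + 1         ≡⟨ +-comm _ 1 ⟩
        suc ∣ remove F e ∣           ≡⟨ ∣remove∣ e∈F ⟩
        ∣ F ∣                        ∎)
        where
        open ≤-Reasoning
        reroute : ∀ {x} → x ∈ F → Path end₁ end₂ (remove F e) (end₁ x) (end₂ x)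
        reroute {x} x∈F with x ≟ e
        ... | yes refl = detour
        ... | no x≢e   = edge (∈-remove⁺ x∈F x≢e)
      acyclic : Acyclic G F
      acyclic stop (nonempty , _) = nonempty refl
      acyclic (step e e∈F joins w) (_ , e∉w ∷ _ , _) = close joins
        where
        rest : Path end₁ end₂ (remove F e) _ _
        rest = walk⇒path w (All.zipWith (λ (x∈F , e≢x) → ∈-remove⁺ x∈F (e≢x ∘ sym)) (edges∈ w , e∉w))
        close : _ → ⊥
        close (inj₁ (refl , refl)) = bridge e∈F (reverse rest)
        close (inj₂ (refl , refl)) = bridge e∈F rest

    connected⇒connectedOn⊤ : Connected G ⊤ → ConnectedOn G ⊤
    connected⇒connectedOn⊤ connected {u} {v} _ _ = walk⇒path (connected u v)
      (All.universal (λ e → ∈⟦⟧⁺ (within? G ⊤) (∈⊤ , ∈⊤)) _)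

    -- Deleting an empty edge set leaves a connected graph connected.
    mincut-positive : Connected G ⊤ → ∀ {c} → IsMinCutValue G c → 0 < c
    mincut-positive connected {suc c} _ = s≤s z≤n
    mincut-positive connected {zero} ((D , disconnecting , ∣D∣≡0) , _) = contradiction
      (λ u v → path⇒walk (walk⇒path (connected u v) (All.universal (λ e → x∉p⇒x∈∁p (e∉D e)) _))) disconnecting
      where
      e∉D : ∀ e → e ∉ D
      e∉D e e∈D = <⇒≱ (∈⇒0<∣∣ e∈D) (≤-reflexive ∣D∣≡0)

    module _ {ℓ : Fin #E → ℚ} {N : ℕ} (p : GoodPacking G (suc N) (Close G ℓ N) ⊤) where
      private module P = GoodPacking p

      packing : TreePacking G
      packing = record
        { size = suc N ; tree = P.tree
        ; isSpanningTree = λ t → connected-small⇒tree (λ u v → P.spans t ∈⊤ ∈⊤)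
            (≤-trans (P.small t) (≤-reflexive (∣⊤∣≡n #V))) }

      load≡edgeLoad : ∀ e → load packing e ≡ edgeLoad P.tree e
      load≡edgeLoad e = trans (∣p∣≡sum (tabulate (λ i → lookup (P.tree i) e)))
        (sum-cong-≗ λ i → cong bit (lookup∘tabulate (λ i → lookup (P.tree i) e) i))

      packing-close : ∀ e → ℚ.∣ relLoad packing e ℚ.- ℓ e ∣ ℚ.≤ + 1 ℚ./ suc N
      packing-close e = subst (λ l → ℚ.∣ + l ℚ./ suc N ℚ.- ℓ e ∣ ℚ.≤ + 1 ℚ./ suc N) (sym (load≡edgeLoad e))
        (P.good (∈⟦⟧⁺ (within? G ⊤) (∈⊤ , ∈⊤)))

  -- Choosing the number of trees for a real `ε`.

  module _ (ε : ℝ) where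
    open ℝ ε

    lower-≤ : ∀ {p q} → p ℚ.≤ q → q <ʳ ε → p <ʳ ε
    lower-≤ p≤q q<ε = let r , q<r , r<ε = lower-open q<ε in lower-closed (ℚ.≤-<-trans p≤q q<r) r<ε

    below⇒≤ʳ : ∀ {p q} → p ℚ.≤ q → q <ʳ ε → p ≤ʳ ε
    below⇒≤ʳ p≤q q<ε ε<p = disjoint (lower-≤ p≤q q<ε , ε<p)

    above⇒ʳ≤ : ∀ {p q} → p ℚ.≤ q → ε ʳ< p → ε ʳ≤ q
    above⇒ʳ≤ p≤q ε<p q<ε = disjoint (lower-≤ p≤q q<ε , ε<p)

    archimedean : ∀ c → 0ℚ <ʳ ε → ∃[ n ] (+ c ℚ./ suc n) <ʳ ε
    archimedean c 0<ε with lower-open 0<ε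
    ... | mkℚ (+ zero)  d _ , ℚ.*<* (ℤ.+<+ ()) , _
    ... | mkℚ ℤ.-[1+ _ ] d _ , ℚ.*<* () , _
    -- The denominator `c * suc d + 1` makes the fraction smaller than `1 / suc d`, hence smaller
    -- than `q`.
    ... | q@(mkℚ (+ suc a) d coprime) , _ , q<ε = c * suc d , lower-closed
      (subst (_ ℚ.<_) (ℚ.↥p/↧p≡p q) (/-mono-< c (c * suc d) (suc a) d
        (≤-trans (n<1+n (c * suc d)) (m≤m+n (suc (c * suc d)) _)))) q<ε

    -- A downward search from a large n: it keeps c / (2 + n) as soon as locatedness answers
    -- ε < 2 c / (1 + n), which is at most 5 c / (2 + n), and otherwise has c / (1 + n) < ε.
    scale : ∀ {c} → 0 < c → 0ℚ <ʳ ε → ε ʳ≤ 1ℚ →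
            ∃[ n ] (+ c ℚ./ suc n) <ʳ ε × ε ʳ≤ (+ 5 ℚ./ 1) ℚ.* (+ c ℚ./ suc n)
    scale {c} 0<c 0<ε ε≤1 = let n , low = archimedean c 0<ε in descend n low
      where
      5c/ : ∀ n → (+ 5 ℚ./ 1) ℚ.* (+ c ℚ./ suc n) ≡ + (5 * c) ℚ./ (1 * suc n)
      5c/ n = /-* 5 0 c n
      descend : ∀ n → (+ c ℚ./ suc n) <ʳ ε →
                ∃[ n ] (+ c ℚ./ suc n) <ʳ ε × ε ʳ≤ (+ 5 ℚ./ 1) ℚ.* (+ c ℚ./ suc n)
      -- A single tree suffices here, as `ε` is at most 1 and `c` is at least 1.
      descend zero low = 0 , low , λ 5c<ε → ε≤1 (lower-≤ (subst (1ℚ ℚ.≤_) (sym (5c/ 0))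
        (/-mono-≤ 1 0 (5 * c) 0 (*-monoˡ-≤ 1 (*-mono-≤ {1} {5} (s≤s z≤n) 0<c)))) 5c<ε)
      descend (suc n) low with located {+ c ℚ./ suc n} {+ (2 * c) ℚ./ suc n}
        (/-mono-< c n (2 * c) n (*-monoˡ-< (suc n) (m<m+n c (≤-trans 0<c (m≤m+n c 0)))))
      ... | inj₁ low′ = descend n low′
      ... | inj₂ high = suc n , low , above⇒ʳ≤ (subst (+ (2 * c) ℚ./ suc n ℚ.≤_) (sym (5c/ (suc n)))
        (/-mono-≤ (2 * c) n (5 * c) (suc n + 0) (enough c n))) high
        where
        enough : ∀ c n → 2 * c * (2 + n + 0) ≤ 5 * c * suc n
        enough c n = ≤-trans (m≤m+n _ (c + 3 * c * n)) (≤-reflexive (identity c n))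
          where
          identity : ∀ c n → 2 * c * (2 + n + 0) + (c + 3 * c * n) ≡ 5 * c * suc n
          identity = solve-∀

-- Constants and final bounds.

open import Defs
open import Data.Fin.Subset using (⊤)
open import Data.Integer.Base as ℤ using (+_)
open import Data.Nat.Base as ℕ using (ℕ)
import Data.Nat.Properties as ℕ
open import Data.Nat.Tactic.RingSolver using (solve-∀)
open import Data.Product.Base using (_,_; ∃-syntax; _×_)
open import Data.Rational.Base using (ℚ; 0ℚ; 1ℚ; _<_; _≤_; _-_; _*_; _/_; ∣_∣; *<*)
import Data.Rational.Properties as ℚ
open import Relation.Binary.PropositionalEquality.Core using (_≡_; sym; subst)

scaled-deviation : ∀ c n {x} → x ≤ + 1 / ℕ.suc n → x * (+ c / 1) ≤ + c / ℕ.suc n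
scaled-deviation c n {x} x≤ = ℚ.≤-trans
  (ℚ.*-monoʳ-≤-nonNeg (+ c / 1) {{ℚ.normalize-nonNeg c 1}} x≤)
  (subst (_≤ + c / ℕ.suc n) (sym (/-* 1 n c 0))
    (/-mono-≤ (1 ℕ.* c) (n ℕ.* 1) c n (ℕ.≤-reflexive (rearrange c n))))
  where
  rearrange : ∀ c n → 1 ℕ.* c ℕ.* ℕ.suc n ≡ c ℕ.* ℕ.suc (n ℕ.* 1)
  rearrange = solve-∀

theorem2 : ∃[ c₁ ] ∃[ c₂ ] 0ℚ < c₁ × 0ℚ < c₂ ×
    ((G : Multigraph) → 2 ℕ.≤ #V G → Connected G ⊤ →
    (mincut : ℕ) → IsMinCutValue G mincut →
    (ε : ℝ) → 0ℚ <ʳ ε → ε ʳ≤ 1ℚ →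
    (ℓ* : E G → ℚ) → IsIdealLoad G ℓ* →
    ∃[ T ]
    c₁ * (+ mincut / size {G} T) ≤ʳ ε ×
    ε ʳ≤ c₂ * (+ mincut / size {G} T) ×
    (∀ e → ∣ relLoad {G} T e - ℓ* e ∣ * (+ mincut / 1) ≤ʳ ε))
theorem2 = 1ℚ , + 5 / 1 , *<* (ℤ.+<+ (ℕ.s≤s ℕ.z≤n)) , *<* (ℤ.+<+ (ℕ.s≤s ℕ.z≤n)) ,
  λ G _ connected c c-mincut ε 0<ε ε≤1 ℓ* ideal →
    -- With `suc n` trees, `ε` lies above `c / suc n` and is at most five times this value, whence
    -- the constants 1 and 5. The tolerance `1 / suc n`, multiplied by `c`, is also below `ε`.
    let n , low , high = scale ε (mincut-positive G connected c-mincut) 0<ε ε≤1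
        p = close-packing G ℓ* n (connected⇒connectedOn⊤ G connected) ideal
    in packing G p , below⇒≤ʳ ε (ℚ.≤-reflexive (ℚ.*-identityˡ _)) low , high ,
       λ e → below⇒≤ʳ ε (scaled-deviation c n (packing-close G p e)) low
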